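{- Let $\mathcal D_\otimes:\mathbf{MV_{ss}}\to\mathbf{DMV_{ss}}$ be the functor given by $\mathcal D_\otimes(B)=[0,1]_{\mathbb Q}\otimes B$ for any semisimple MV-algebra $B$ and $\mathcal D_\otimes(f)=\widetilde f$ for any homomorphism of MV-algebras $f:A\to B$, where $\widetilde f:[0,1]_{\mathbb Q}\otimes A\to[0,1]_{\mathbb Q}\otimes B$ is the unique homomorphism of DMV-algebras such that $\widetilde f\circ\iota_A=\iota_B\circ f$. Let $\mathcal U_\delta:\mathbf{DMV_{ss}}\to\mathbf{MV_{ss}}$ be the forgetful functor. Then $(\mathcal D_\otimes,\mathcal U_\delta)$ is an adjoint pair ($\mathcal D_\otimes$ is left adjoint to $\mathcal U_\delta$).
   Context: An MV-algebra is a structure $(A,\oplus,{}^*,0)$ such that $(A,\oplus,0)$ is an Abelian monoid, $(x^*)^*=x$, $(x^*\oplus y)^*\oplus y=(y^*\oplus x)^*\oplus x$ and $0^*\oplus x=0^*$; put $1=0^*$, $x\odot y=(x^*\oplus y^*)^*$, $x\vee y=(x\odot y^*)\oplus y$, $x\wedge y=(x\oplus y^*)\odot y$. The partial sum $x+y$ is defined iff $x\odot y=0$, and then $x+y=x\oplus y$. An MV-algebra is semisimple if the intersection $Rad$ of its maximal ideals is $\{0\}$. A DMV-algebra is an MV-algebra with unary operators $\{\delta_n\}_{n\ge1}$ satisfying $n\delta_nx=x$ and $\delta_nx\odot(n-1)\delta_nx=0$ ($n x$ denotes the $n$-fold $\oplus$-sum); it is semisimple iff its MV-reduct is. $\mathbf{MV_{ss}}$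 and $\mathbf{DMV_{ss}}$ are the categories of semisimple MV-algebras and semisimple DMV-algebras with all MV-, respectively DMV-, homomorphisms. $[0,1]_{\mathbb Q}=[0,1]\cap\mathbb Q$ with $x\oplus y=\min\{x+y,1\}$, $x^*=1-x$. Tensor product: a bimorphism $\beta:A\times B\to C$ of MV-algebras is a map with $\beta(1,1)=1$ that preserves $\vee,\wedge$ and (whenever defined) the partial sum $+$ in each argument separately. The MV-algebraic tensor product $A\otimes_{MV}B$ is the MV-algebra with a universal bimorphism $A\times B\to A\otimes_{MV}B$, $(a,b)\mapsto a\otimes_{MV}b$: every bimorphism $A\times B\to C$ factors uniquely through it by an MV-homomorphism. For semisimple $A,B$, the semisimple tensor product is $A\otimes B=(A\otimes_{MV}B)/Rad(A\otimes_{MV}B)$, and $a\otimes b$ is the class of $a\otimes_{MV}b$; it has the same universal property with respect to semisimple $C$. For $B$ semisimple, $[0,1]_{\mathbb Q}\otimes B$ is a semisimple DMV-algebra, and $\iota_B:B\to[0,1]_{\mathbb Q}\otimes B$ is $\iota_B(b)=1\otimes b$. -}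

module Defs where

open import Level using (Level; _⊔_; 0ℓ) renaming (suc to lsuc)
open import Algebra.Core using (Op₁; Op₂)
open import Algebra.Bundles using (CommutativeMonoid)
open import Algebra.Structures using (IsCommutativeMonoid)
import Algebra.Definitions.RawMonoid as RawMonoidDefinitions
import Algebra.Properties.CommutativeSemigroup as CommutativeSemigroupProperties
open import Data.Nat.Base using (ℕ; pred; NonZero)
open import Data.Product.Base using (Σ-syntax; _×_; _,_; proj₁; proj₂)
open import Data.Rational as ℚ using (ℚ; 0ℚ; 1ℚ)
import Data.Rational.Properties as ℚₚ
open import Function.Base using (id; _∘_)
open import Function.Bundles using (Inverse)
open import Relation.Binary using (Rel; IsEquivalence; Setoid; _Respects_)
open import Relation.Binary.PropositionalEquality as ≡ using (_≡_)
import Relation.Binary.Reasoning.Setoid as SetoidReasoning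
open import Relation.Nullary using (¬_)
open import Relation.Unary using (Pred; _∈_; _⊆_)

private
  variable
    a b c p ℓ ℓ₁ ℓ₂ ℓ₃ o h e o′ h′ e′ : Level

module MVOperations {A : Set a} (_⊕_ : Op₂ A) (_* : Op₁ A) (0# : A) where

  1# : A
  1# = 0# *

  infixl 7 _⊙_
  infixl 6 _∨_ _∧_

  _⊙_ : Op₂ A
  x ⊙ y = ((x *) ⊕ (y *)) *

  _∨_ : Op₂ A
  x ∨ y = (x ⊙ (y *)) ⊕ y

  _∧_ : Op₂ A
  x ∧ y = (x ⊕ (y *)) ⊙ y

record MVAlgebra (c ℓ : Level) : Set (lsuc (c ⊔ ℓ)) where
  infix  4 _≈_
  infixl 6 _⊕_
  infix  8 _*
  field
    Carrier             : Set c
    _≈_                 : Rel Carrier ℓ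
    _⊕_                 : Op₂ Carrier
    _*                  : Op₁ Carrier
    0#                  : Carrier
    isCommutativeMonoid : IsCommutativeMonoid _≈_ _⊕_ 0#
    *-cong              : ∀ {x y} → x ≈ y → x * ≈ y *
    *-involutive        : ∀ x → (x *) * ≈ x
    łukasiewicz         : ∀ x y → (x * ⊕ y) * ⊕ y ≈ (y * ⊕ x) * ⊕ x
    ⊕-zeroˡ             : ∀ x → 0# * ⊕ x ≈ 0# *

  open IsCommutativeMonoid isCommutativeMonoid public
    using (isEquivalence; refl; sym; trans; setoid)
    renaming ( ∙-cong to ⊕-cong; assoc to ⊕-assoc; comm to ⊕-comm
             ; identityˡ to ⊕-identityˡ; identityʳ to ⊕-identityʳ )

  open MVOperations _⊕_ _* 0# public

  commutativeMonoid : CommutativeMonoid c ℓ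
  commutativeMonoid = record { isCommutativeMonoid = isCommutativeMonoid }

  open RawMonoidDefinitions (CommutativeMonoid.rawMonoid commutativeMonoid) public
    using () renaming (_×_ to _·_)

  infix 4 _≤_ _⊥_

  _≤_ : Rel Carrier ℓ
  x ≤ y = x * ⊕ y ≈ 1#

  -- The partial sum x + y is defined when x ⊥ y, and is then x ⊕ y.
  _⊥_ : Rel Carrier ℓ
  x ⊥ y = x ⊙ y ≈ 0#

  -- Chang's distance; x and y are congruent modulo an ideal I when d x y ∈ I.
  d : Op₂ Carrier
  d x y = (x ⊙ y *) ⊕ (y ⊙ x *)

record MVHomomorphism (A : MVAlgebra a ℓ₁) (B : MVAlgebra b ℓ₂)
       : Set (a ⊔ b ⊔ ℓ₁ ⊔ ℓ₂) where
  private
    module A = MVAlgebra A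
    module B = MVAlgebra B
  field
    ⟦_⟧    : A.Carrier → B.Carrier
    cong   : ∀ {x y} → x A.≈ y → ⟦ x ⟧ B.≈ ⟦ y ⟧
    ⊕-homo : ∀ x y → ⟦ x A.⊕ y ⟧ B.≈ ⟦ x ⟧ B.⊕ ⟦ y ⟧
    *-homo : ∀ x → ⟦ x A.* ⟧ B.≈ ⟦ x ⟧ B.*
    0-homo : ⟦ A.0# ⟧ B.≈ B.0#

-- Subsets are predicates with values in a fixed universe Set p.
record Ideal (A : MVAlgebra c ℓ) (p : Level) : Set (c ⊔ ℓ ⊔ lsuc p) where
  open MVAlgebra A
  field
    Member   : Pred Carrier p
    resp-≈   : Member Respects _≈_
    0-closed : 0# ∈ Member
    ≤-closed : ∀ {x y} → x ≤ y → y ∈ Member → x ∈ Member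
    ⊕-closed : ∀ {x y} → x ∈ Member → y ∈ Member → x ⊕ y ∈ Member

open Ideal using (Member)

Proper : {A : MVAlgebra c ℓ} → Ideal A p → Set p
Proper {A = A} I = ¬ (MVAlgebra.1# A ∈ Member I)

record Maximal {A : MVAlgebra c ℓ} (I : Ideal A p) : Set (c ⊔ ℓ ⊔ lsuc p) where
  field
    proper  : Proper I
    maximal : (J : Ideal A p) → Proper J → Member I ⊆ Member J → Member J ⊆ Member I

InRad : (p : Level) (A : MVAlgebra c ℓ) → Pred (MVAlgebra.Carrier A) (c ⊔ ℓ ⊔ lsuc p)
InRad p A x = (I : Ideal A p) → Maximal I → x ∈ Member I

Semisimple : (p : Level) (A : MVAlgebra c ℓ) → Set (c ⊔ ℓ ⊔ lsuc p)
Semisimple p A = ∀ x → InRad p A x → x ≈ 0#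
  where open MVAlgebra A

module MVProperties (A : MVAlgebra c ℓ) where
  open MVAlgebra A
  open SetoidReasoning setoid
  open CommutativeSemigroupProperties
    (CommutativeMonoid.commutativeSemigroup commutativeMonoid)
    using (interchange)

  ⊕-congˡ : ∀ {x y z} → y ≈ z → x ⊕ y ≈ x ⊕ z
  ⊕-congˡ = ⊕-cong refl

  ⊕-congʳ : ∀ {x y z} → y ≈ z → y ⊕ x ≈ z ⊕ x
  ⊕-congʳ q = ⊕-cong q refl

  ⊕-zeroʳ : ∀ x → x ⊕ 1# ≈ 1#
  ⊕-zeroʳ x = trans (⊕-comm x 1#) (⊕-zeroˡ x)

  *-inverseˡ : ∀ x → x * ⊕ x ≈ 1#
  *-inverseˡ x = begin
    x * ⊕ x             ≈⟨ ⊕-congʳ (*-cong (trans (⊕-congʳ (*-involutive 0#)) (⊕-identityˡ x))) ⟨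
    (1# * ⊕ x) * ⊕ x    ≈⟨ łukasiewicz x 1# ⟨
    (x * ⊕ 1#) * ⊕ 1#   ≈⟨ ⊕-zeroʳ _ ⟩
    1#                  ∎

  ≤-respˡ : ∀ {x y z} → x ≈ y → x ≤ z → y ≤ z
  ≤-respˡ q r = trans (⊕-congʳ (*-cong (sym q))) r

  ≤-respʳ : ∀ {x y z} → y ≈ z → x ≤ y → x ≤ z
  ≤-respʳ q r = trans (⊕-congˡ (sym q)) r

  ≤-reflexive : ∀ {x y} → x ≈ y → x ≤ y
  ≤-reflexive {x} q = ≤-respʳ q (*-inverseˡ x)

  x≤x⊕y : ∀ x y → x ≤ x ⊕ y
  x≤x⊕y x y = begin
    x * ⊕ (x ⊕ y)   ≈⟨ ⊕-assoc _ _ _ ⟨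
    x * ⊕ x ⊕ y     ≈⟨ ⊕-congʳ (*-inverseˡ x) ⟩
    1# ⊕ y          ≈⟨ ⊕-zeroˡ y ⟩
    1#              ∎

  x≤y⊕x : ∀ x y → x ≤ y ⊕ x
  x≤y⊕x x y = ≤-respʳ (⊕-comm x y) (x≤x⊕y x y)

  difference : ∀ {x y} → x ≤ y → y ≈ x ⊕ (y * ⊕ x) *
  difference {x} {y} x≤y = begin
    y                   ≈⟨ ⊕-identityˡ y ⟨
    0# ⊕ y              ≈⟨ ⊕-congʳ (*-involutive 0#) ⟨
    1# * ⊕ y            ≈⟨ ⊕-congʳ (*-cong x≤y) ⟨
    (x * ⊕ y) * ⊕ y     ≈⟨ łukasiewicz x y ⟩
    (y * ⊕ x) * ⊕ x     ≈⟨ ⊕-comm _ _ ⟩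
    x ⊕ (y * ⊕ x) *     ∎

  ≤-trans : ∀ {x y z} → x ≤ y → y ≤ z → x ≤ z
  ≤-trans {x} {y} {z} x≤y y≤z = begin
    x * ⊕ z               ≈⟨ ⊕-congˡ (difference y≤z) ⟩
    x * ⊕ (y ⊕ _)         ≈⟨ ⊕-assoc _ _ _ ⟨
    x * ⊕ y ⊕ _           ≈⟨ ⊕-congʳ x≤y ⟩
    1# ⊕ _                ≈⟨ ⊕-zeroˡ _ ⟩
    1#                    ∎

  ⊕-mono-≤ : ∀ {x x′ y y′} → x ≤ x′ → y ≤ y′ → x ⊕ y ≤ x′ ⊕ y′
  ⊕-mono-≤ {x} {x′} {y} {y′} p q =
    ≤-respʳ (sym (trans (⊕-cong (difference p) (difference q)) (interchange x _ y _)))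
            (x≤x⊕y (x ⊕ y) _)

  -- Residuation: x ⊙ y * ≤ z exactly when x ≤ y ⊕ z.
  residual-eq : ∀ x y z → (x ⊙ y *) * ⊕ z ≈ x * ⊕ (y ⊕ z)
  residual-eq x y z = begin
    (x ⊙ y *) * ⊕ z           ≈⟨ ⊕-congʳ (*-involutive _) ⟩
    x * ⊕ (y *) * ⊕ z         ≈⟨ ⊕-congʳ (⊕-congˡ (*-involutive y)) ⟩
    x * ⊕ y ⊕ z               ≈⟨ ⊕-assoc _ _ _ ⟩
    x * ⊕ (y ⊕ z)             ∎

  residual : ∀ {x y z} → x ≤ y ⊕ z → x ⊙ y * ≤ z
  residual {x} {y} {z} = trans (residual-eq x y z)

  x≤y⊕[x⊖y] : ∀ x y → x ≤ y ⊕ (x ⊙ y *)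
  x≤y⊕[x⊖y] x y = trans (sym (residual-eq x y _)) (*-inverseˡ _)

  ⊖-triangle : ∀ x y z → x ⊙ z * ≤ (x ⊙ y *) ⊕ (y ⊙ z *)
  ⊖-triangle x y z = residual
    (≤-trans (x≤y⊕[x⊖y] x y)
      (≤-respʳ (trans (⊕-assoc _ _ _) (⊕-congˡ (⊕-comm _ _)))
        (⊕-mono-≤ (x≤y⊕[x⊖y] y z) (≤-reflexive refl))))

  ⊖-⊕ : ∀ x x′ y y′ → (x ⊕ x′) ⊙ (y ⊕ y′) * ≤ (x ⊙ y *) ⊕ (x′ ⊙ y′ *)
  ⊖-⊕ x x′ y y′ = residual
    (≤-respʳ (interchange y _ y′ _) (⊕-mono-≤ (x≤y⊕[x⊖y] x y) (x≤y⊕[x⊖y] x′ y′)))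

  ⊙-comm : ∀ x y → x ⊙ y ≈ y ⊙ x
  ⊙-comm x y = *-cong (⊕-comm _ _)

  ⊙-cong : ∀ {x x′ y y′} → x ≈ x′ → y ≈ y′ → x ⊙ y ≈ x′ ⊙ y′
  ⊙-cong q r = *-cong (⊕-cong (*-cong q) (*-cong r))

  ⊖-self : ∀ {x y} → x ≈ y → x ⊙ y * ≈ 0#
  ⊖-self {x} {y} q = trans (*-cong (trans (⊕-congˡ (*-involutive y)) (≤-reflexive q)))
                           (*-involutive 0#)

  ⊖-* : ∀ x y → x * ⊙ (y *) * ≈ y ⊙ x *
  ⊖-* x y = trans (⊙-cong refl (*-involutive y)) (⊙-comm _ _)

  ⊖-identity : ∀ x → x ⊙ 0# * ≈ x
  ⊖-identity x = trans (*-cong (trans (⊕-congˡ (*-involutive 0#)) (⊕-identityʳ _)))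
                       (*-involutive x)

module Quotient {c ℓ p} (A : MVAlgebra c ℓ) (I : Ideal A p) where
  open MVAlgebra A
  open MVProperties A
  open Ideal I using (resp-≈; 0-closed; ≤-closed; ⊕-closed)

  _∼_ : Rel Carrier p
  x ∼ y = d x y ∈ Member I

  private
    both : ∀ {x y} → x ⊙ y * ∈ Member I → y ⊙ x * ∈ Member I → x ∼ y
    both = ⊕-closed

    fst : ∀ {x y} → x ∼ y → x ⊙ y * ∈ Member I
    fst = ≤-closed (x≤x⊕y _ _)

    snd : ∀ {x y} → x ∼ y → y ⊙ x * ∈ Member I
    snd = ≤-closed (x≤y⊕x _ _)

    half-trans : ∀ {x y z} → x ⊙ y * ∈ Member I → y ⊙ z * ∈ Member I → x ⊙ z * ∈ Member I
    half-trans q r = ≤-closed (⊖-triangle _ _ _) (⊕-closed q r)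

  ≈⇒∼ : ∀ {x y} → x ≈ y → x ∼ y
  ≈⇒∼ q = both (resp-≈ (sym (⊖-self q)) 0-closed) (resp-≈ (sym (⊖-self (sym q))) 0-closed)

  ∼-isEquivalence : IsEquivalence _∼_
  ∼-isEquivalence = record
    { refl  = ≈⇒∼ refl
    ; sym   = λ q → both (snd q) (fst q)
    ; trans = λ q r → both (half-trans (fst q) (fst r)) (half-trans (snd r) (snd q))
    }

  ∼-⊕-cong : ∀ {x x′ y y′} → x ∼ x′ → y ∼ y′ → (x ⊕ y) ∼ (x′ ⊕ y′)
  ∼-⊕-cong q r = both (≤-closed (⊖-⊕ _ _ _ _) (⊕-closed (fst q) (fst r)))
                      (≤-closed (⊖-⊕ _ _ _ _) (⊕-closed (snd q) (snd r)))

  ∼-*-cong : ∀ {x y} → x ∼ y → (x *) ∼ (y *)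
  ∼-*-cong q = both (resp-≈ (sym (⊖-* _ _)) (snd q)) (resp-≈ (sym (⊖-* _ _)) (fst q))

  quotient : MVAlgebra c p
  quotient = record
    { Carrier             = Carrier
    ; _≈_                 = _∼_
    ; _⊕_                 = _⊕_
    ; _*                  = _*
    ; 0#                  = 0#
    ; isCommutativeMonoid = record
      { isMonoid = record
        { isSemigroup = record
          { isMagma = record { isEquivalence = ∼-isEquivalence ; ∙-cong = ∼-⊕-cong }
          ; assoc   = λ x y z → ≈⇒∼ (⊕-assoc x y z)
          }
        ; identity = (λ x → ≈⇒∼ (⊕-identityˡ x)) , (λ x → ≈⇒∼ (⊕-identityʳ x))
        }
      ; comm = λ x y → ≈⇒∼ (⊕-comm x y)
      }
    ; *-cong              = ∼-*-cong
    ; *-involutive        = λ x → ≈⇒∼ (*-involutive x)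
    ; łukasiewicz         = λ x y → ≈⇒∼ (łukasiewicz x y)
    ; ⊕-zeroˡ             = λ x → ≈⇒∼ (⊕-zeroˡ x)
    }

Rad : (p : Level) (A : MVAlgebra c ℓ) → Ideal A (c ⊔ ℓ ⊔ lsuc p)
Rad p A = record
  { Member   = InRad p A
  ; resp-≈   = λ q x∈ I I-max → Ideal.resp-≈ I q (x∈ I I-max)
  ; 0-closed = λ I _ → Ideal.0-closed I
  ; ≤-closed = λ q y∈ I I-max → Ideal.≤-closed I q (y∈ I I-max)
  ; ⊕-closed = λ x∈ y∈ I I-max → Ideal.⊕-closed I (x∈ I I-max) (y∈ I I-max)
  }

infixl 7 _/Rad[_]

_/Rad[_] : MVAlgebra c ℓ → (p : Level) → MVAlgebra c (c ⊔ ℓ ⊔ lsuc p)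
A /Rad[ p ] = Quotient.quotient A (Rad p A)

/Rad-semisimple : (A : MVAlgebra c ℓ) (p : Level) → Semisimple p (A /Rad[ p ])
/Rad-semisimple {c = c} {ℓ = ℓ} A p x x∈Rad I I-max =
  Ideal.resp-≈ I (sym d-0) (x∈Rad (pushforward I I-max) pushforward-maximal)
  where
  open MVAlgebra A
  open MVProperties A
  open Quotient A (Rad p A)

  d-0 : d x 0# ≈ x
  d-0 = trans (⊕-cong (⊖-identity x) (trans (⊙-comm _ _) annihil)) (⊕-identityʳ x)
    where
    annihil : x * ⊙ 0# ≈ 0#
    annihil = trans (*-cong (⊕-zeroʳ _)) (*-involutive 0#)

  ∼-closed : (J : Ideal A p) → Maximal J → ∀ {y z} → y ∼ z → y ∈ Member J → z ∈ Member J
  ∼-closed J J-max {y} {z} y∼z y∈J = Ideal.≤-closed J (x≤y⊕[x⊖y] z y)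
    (Ideal.⊕-closed J y∈J (Ideal.≤-closed J (x≤y⊕x _ _) (y∼z J J-max)))

  pushforward : (J : Ideal A p) → Maximal J → Ideal (A /Rad[ p ]) p
  pushforward J J-max = record
    { Member   = Member J
    ; resp-≈   = ∼-closed J J-max
    ; 0-closed = Ideal.0-closed J
    ; ≤-closed = λ {y} {z} y≤z z∈J → ∼-closed J J-max
        (MVProperties.⊖-identity (A /Rad[ p ]) y)
        (Ideal.≤-closed J (residual (≤-reflexive′ y z)) (Ideal.⊕-closed J z∈J (gap y≤z)))
    ; ⊕-closed = Ideal.⊕-closed J
    }
    where
    gap : ∀ {y z} → (y * ⊕ z) ∼ 1# → y ⊙ z * ∈ Member J
    gap {y} {z} y≤z = Ideal.resp-≈ J eq (Ideal.≤-closed J (x≤y⊕x _ _) (y≤z J J-max))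
      where
      eq : 1# ⊙ (y * ⊕ z) * ≈ y ⊙ z *
      eq = trans (⊙-comm _ _)
             (trans (⊖-identity _) (*-cong (⊕-cong refl (sym (*-involutive z)))))
    ≤-reflexive′ : ∀ y z → y ≤ 0# ⊕ (z ⊕ (y ⊙ z *))
    ≤-reflexive′ y z = ≤-respʳ (sym (⊕-identityˡ _)) (x≤y⊕[x⊖y] y z)

  pullback : Ideal (A /Rad[ p ]) p → Ideal A p
  pullback J = record
    { Member   = Member J
    ; resp-≈   = λ q → Ideal.resp-≈ J (≈⇒∼ q)
    ; 0-closed = Ideal.0-closed J
    ; ≤-closed = λ q → Ideal.≤-closed J (≈⇒∼ q)
    ; ⊕-closed = Ideal.⊕-closed J
    }

  pushforward-maximal : Maximal (pushforward I I-max)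
  pushforward-maximal = record
    { proper  = Maximal.proper I-max
    ; maximal = λ J → Maximal.maximal I-max (pullback J)
    }

record Bimorphism (A : MVAlgebra a ℓ₁) (B : MVAlgebra b ℓ₂) (C : MVAlgebra c ℓ₃)
       : Set (a ⊔ b ⊔ c ⊔ ℓ₁ ⊔ ℓ₂ ⊔ ℓ₃) where
  private
    module A = MVAlgebra A
    module B = MVAlgebra B
    module C = MVAlgebra C
  field
    β      : A.Carrier → B.Carrier → C.Carrier
    β-cong : ∀ {x x′ y y′} → x A.≈ x′ → y B.≈ y′ → β x y C.≈ β x′ y′
    β-1    : β A.1# B.1# C.≈ C.1#
    β-∨ˡ   : ∀ x x′ y → β (x A.∨ x′) y C.≈ β x y C.∨ β x′ y
    β-∨ʳ   : ∀ x y y′ → β x (y B.∨ y′) C.≈ β x y C.∨ β x y′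
    β-∧ˡ   : ∀ x x′ y → β (x A.∧ x′) y C.≈ β x y C.∧ β x′ y
    β-∧ʳ   : ∀ x y y′ → β x (y B.∧ y′) C.≈ β x y C.∧ β x y′
    β-⊥ˡ   : ∀ {x x′} y → x A.⊥ x′ → β x y C.⊥ β x′ y
    β-⊥ʳ   : ∀ x {y y′} → y B.⊥ y′ → β x y C.⊥ β x y′
    β-+ˡ   : ∀ {x x′} y → x A.⊥ x′ → β (x A.⊕ x′) y C.≈ β x y C.⊕ β x′ y
    β-+ʳ   : ∀ x {y y′} → y B.⊥ y′ → β x (y B.⊕ y′) C.≈ β x y C.⊕ β x y′

-- A ⊗MV B is realised as MV-terms over the symbols a ⊗ b, modulo the least
-- MV-congruence making (a , b) ↦ a ⊗ b a bimorphism.  Its universal property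
-- (lift, lift-⊗, lift-unique) holds for codomains in arbitrary universes.
module MVTensor {a b ℓ₁ ℓ₂} (A : MVAlgebra a ℓ₁) (B : MVAlgebra b ℓ₂) where
  private
    module A = MVAlgebra A
    module B = MVAlgebra B

  infixl 7 _⊗ₜ_
  infixl 6 _⊕ₜ_
  infix  8 _*ₜ

  data Term : Set (a ⊔ b) where
    _⊗ₜ_ : A.Carrier → B.Carrier → Term
    _⊕ₜ_ : Term → Term → Term
    _*ₜ  : Term → Term
    0ₜ   : Term

  open MVOperations _⊕ₜ_ _*ₜ 0ₜ
    renaming (1# to 1ₜ; _⊙_ to _⊙ₜ_; _∨_ to _∨ₜ_; _∧_ to _∧ₜ_)

  infix 4 _≈ₜ_

  data _≈ₜ_ : Rel Term (a ⊔ b ⊔ ℓ₁ ⊔ ℓ₂) where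
    reflₜ       : ∀ {s} → s ≈ₜ s
    symₜ        : ∀ {s t} → s ≈ₜ t → t ≈ₜ s
    transₜ      : ∀ {s t u} → s ≈ₜ t → t ≈ₜ u → s ≈ₜ u
    ⊕-congₜ     : ∀ {s s′ t t′} → s ≈ₜ s′ → t ≈ₜ t′ → s ⊕ₜ t ≈ₜ s′ ⊕ₜ t′
    *-congₜ     : ∀ {s t} → s ≈ₜ t → s *ₜ ≈ₜ t *ₜ
    ⊕-assocₜ    : ∀ s t u → (s ⊕ₜ t) ⊕ₜ u ≈ₜ s ⊕ₜ (t ⊕ₜ u)
    ⊕-commₜ     : ∀ s t → s ⊕ₜ t ≈ₜ t ⊕ₜ s
    ⊕-identityₜ : ∀ s → 0ₜ ⊕ₜ s ≈ₜ s
    involutiveₜ : ∀ s → (s *ₜ) *ₜ ≈ₜ s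
    łukₜ        : ∀ s t → (s *ₜ ⊕ₜ t) *ₜ ⊕ₜ t ≈ₜ (t *ₜ ⊕ₜ s) *ₜ ⊕ₜ s
    ⊕-zeroₜ     : ∀ s → 0ₜ *ₜ ⊕ₜ s ≈ₜ 0ₜ *ₜ
    ⊗-congₜ     : ∀ {x x′ y y′} → x A.≈ x′ → y B.≈ y′ → x ⊗ₜ y ≈ₜ x′ ⊗ₜ y′
    ⊗-1ₜ        : A.1# ⊗ₜ B.1# ≈ₜ 1ₜ
    ⊗-∨ˡₜ       : ∀ x x′ y → (x A.∨ x′) ⊗ₜ y ≈ₜ x ⊗ₜ y ∨ₜ x′ ⊗ₜ y
    ⊗-∨ʳₜ       : ∀ x y y′ → x ⊗ₜ (y B.∨ y′) ≈ₜ x ⊗ₜ y ∨ₜ x ⊗ₜ y′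
    ⊗-∧ˡₜ       : ∀ x x′ y → (x A.∧ x′) ⊗ₜ y ≈ₜ x ⊗ₜ y ∧ₜ x′ ⊗ₜ y
    ⊗-∧ʳₜ       : ∀ x y y′ → x ⊗ₜ (y B.∧ y′) ≈ₜ x ⊗ₜ y ∧ₜ x ⊗ₜ y′
    ⊗-⊥ˡₜ       : ∀ {x x′} y → x A.⊥ x′ → (x ⊗ₜ y) ⊙ₜ (x′ ⊗ₜ y) ≈ₜ 0ₜ
    ⊗-⊥ʳₜ       : ∀ x {y y′} → y B.⊥ y′ → (x ⊗ₜ y) ⊙ₜ (x ⊗ₜ y′) ≈ₜ 0ₜ
    ⊗-+ˡₜ       : ∀ {x x′} y → x A.⊥ x′ → (x A.⊕ x′) ⊗ₜ y ≈ₜ x ⊗ₜ y ⊕ₜ x′ ⊗ₜ y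
    ⊗-+ʳₜ       : ∀ x {y y′} → y B.⊥ y′ → x ⊗ₜ (y B.⊕ y′) ≈ₜ x ⊗ₜ y ⊕ₜ x ⊗ₜ y′

  tensor : MVAlgebra (a ⊔ b) (a ⊔ b ⊔ ℓ₁ ⊔ ℓ₂)
  tensor = record
    { Carrier             = Term
    ; _≈_                 = _≈ₜ_
    ; _⊕_                 = _⊕ₜ_
    ; _*                  = _*ₜ
    ; 0#                  = 0ₜ
    ; isCommutativeMonoid = record
      { isMonoid = record
        { isSemigroup = record
          { isMagma = record
            { isEquivalence = record { refl = reflₜ ; sym = symₜ ; trans = transₜ }
            ; ∙-cong        = ⊕-congₜ
            }
          ; assoc = ⊕-assocₜ
          }
        ; identity = ⊕-identityₜ , λ s → transₜ (⊕-commₜ s 0ₜ) (⊕-identityₜ s)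
        }
      ; comm = ⊕-commₜ
      }
    ; *-cong              = *-congₜ
    ; *-involutive        = involutiveₜ
    ; łukasiewicz         = łukₜ
    ; ⊕-zeroˡ             = ⊕-zeroₜ
    }

  ⊗-bimorphism : Bimorphism A B tensor
  ⊗-bimorphism = record
    { β      = _⊗ₜ_
    ; β-cong = ⊗-congₜ
    ; β-1    = ⊗-1ₜ
    ; β-∨ˡ   = ⊗-∨ˡₜ
    ; β-∨ʳ   = ⊗-∨ʳₜ
    ; β-∧ˡ   = ⊗-∧ˡₜ
    ; β-∧ʳ   = ⊗-∧ʳₜ
    ; β-⊥ˡ   = ⊗-⊥ˡₜ
    ; β-⊥ʳ   = ⊗-⊥ʳₜ
    ; β-+ˡ   = ⊗-+ˡₜ
    ; β-+ʳ   = ⊗-+ʳₜ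
    }

  module _ {C : MVAlgebra c ℓ₃} (F : Bimorphism A B C) where
    private
      module C = MVAlgebra C
      module P = MVProperties C
    open Bimorphism F

    eval : Term → C.Carrier
    eval (x ⊗ₜ y) = β x y
    eval (s ⊕ₜ t) = eval s C.⊕ eval t
    eval (s *ₜ)   = eval s C.*
    eval 0ₜ       = C.0#

    eval-cong : ∀ {s t} → s ≈ₜ t → eval s C.≈ eval t
    eval-cong reflₜ           = C.refl
    eval-cong (symₜ q)        = C.sym (eval-cong q)
    eval-cong (transₜ q r)    = C.trans (eval-cong q) (eval-cong r)
    eval-cong (⊕-congₜ q r)   = C.⊕-cong (eval-cong q) (eval-cong r)
    eval-cong (*-congₜ q)     = C.*-cong (eval-cong q)
    eval-cong (⊕-assocₜ _ _ _) = C.⊕-assoc _ _ _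
    eval-cong (⊕-commₜ _ _)   = C.⊕-comm _ _
    eval-cong (⊕-identityₜ _) = C.⊕-identityˡ _
    eval-cong (involutiveₜ _) = C.*-involutive _
    eval-cong (łukₜ _ _)      = C.łukasiewicz _ _
    eval-cong (⊕-zeroₜ _)     = C.⊕-zeroˡ _
    eval-cong (⊗-congₜ q r)   = β-cong q r
    eval-cong ⊗-1ₜ            = β-1
    eval-cong (⊗-∨ˡₜ x x′ y)  = β-∨ˡ x x′ y
    eval-cong (⊗-∨ʳₜ x y y′)  = β-∨ʳ x y y′
    eval-cong (⊗-∧ˡₜ x x′ y)  = β-∧ˡ x x′ y
    eval-cong (⊗-∧ʳₜ x y y′)  = β-∧ʳ x y y′
    eval-cong (⊗-⊥ˡₜ y q)     = β-⊥ˡ y q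
    eval-cong (⊗-⊥ʳₜ x q)     = β-⊥ʳ x q
    eval-cong (⊗-+ˡₜ y q)     = β-+ˡ y q
    eval-cong (⊗-+ʳₜ x q)     = β-+ʳ x q

    lift : MVHomomorphism tensor C
    lift = record
      { ⟦_⟧    = eval
      ; cong   = eval-cong
      ; ⊕-homo = λ _ _ → C.refl
      ; *-homo = λ _ → C.refl
      ; 0-homo = C.refl
      }

    lift-⊗ : ∀ x y → MVHomomorphism.⟦_⟧ lift (x ⊗ₜ y) C.≈ β x y
    lift-⊗ _ _ = C.refl

    lift-unique : (g : MVHomomorphism tensor C) → let open MVHomomorphism g in
                  (∀ x y → ⟦ x ⊗ₜ y ⟧ C.≈ β x y) →
                  ∀ t → ⟦ t ⟧ C.≈ MVHomomorphism.⟦_⟧ lift t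
    lift-unique g g-⊗ = go
      where
      open MVHomomorphism g
      go : ∀ t → ⟦ t ⟧ C.≈ eval t
      go (x ⊗ₜ y) = g-⊗ x y
      go (s ⊕ₜ t) = C.trans (⊕-homo s t) (C.⊕-cong (go s) (go t))
      go (s *ₜ)   = C.trans (*-homo s) (C.*-cong (go s))
      go 0ₜ       = 0-homo

infixl 7 _⊗MV_ _⊗[_]_

_⊗MV_ : MVAlgebra a ℓ₁ → MVAlgebra b ℓ₂ → MVAlgebra (a ⊔ b) (a ⊔ b ⊔ ℓ₁ ⊔ ℓ₂)
A ⊗MV B = MVTensor.tensor A B

-- The semisimple tensor product; p is the universe of the ideals defining Rad.
_⊗[_]_ : MVAlgebra a ℓ₁ → (p : Level) → MVAlgebra b ℓ₂ →
         MVAlgebra (a ⊔ b) (a ⊔ b ⊔ ℓ₁ ⊔ ℓ₂ ⊔ lsuc p)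
A ⊗[ p ] B = (A ⊗MV B) /Rad[ p ]

module RationalInterval where

  Carrier : Set
  Carrier = Σ[ q ∈ ℚ ] (0ℚ ℚ.≤ q × q ℚ.≤ 1ℚ)

  0≤1 : 0ℚ ℚ.≤ 1ℚ
  0≤1 = ℚₚ.nonNegative⁻¹ 1ℚ

  _⊕ℚ_ : Op₂ ℚ
  x ⊕ℚ y = (x ℚ.+ y) ℚ.⊓ 1ℚ

  _⊕_ : Op₂ Carrier
  (x , 0≤x , _) ⊕ (y , 0≤y , _) =
    x ⊕ℚ y , ℚₚ.⊓-glb (ℚₚ.+-mono-≤ 0≤x 0≤y) 0≤1 , ℚₚ.p⊓q≤q (x ℚ.+ y) 1ℚ

  _* : Op₁ Carrier
  (x , 0≤x , x≤1) * =
    1ℚ ℚ.- x , 0≤1-x , ℚₚ.+-monoʳ-≤ 1ℚ (ℚₚ.neg-antimono-≤ 0≤x)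
    where
    0≤1-x : 0ℚ ℚ.≤ 1ℚ ℚ.- x
    0≤1-x = ≡.subst (ℚ._≤ 1ℚ ℚ.- x) (ℚₚ.+-inverseʳ x) (ℚₚ.+-monoˡ-≤ (ℚ.- x) x≤1)

  open ≡.≡-Reasoning

  truncate : ∀ t z → 0ℚ ℚ.≤ z → ((t ℚ.⊓ 1ℚ) ℚ.+ z) ℚ.⊓ 1ℚ ≡ (t ℚ.+ z) ℚ.⊓ 1ℚ
  truncate t z 0≤z = begin
    ((t ℚ.⊓ 1ℚ) ℚ.+ z) ℚ.⊓ 1ℚ
      ≡⟨ ≡.cong (ℚ._⊓ 1ℚ) (ℚₚ.mono-≤-distrib-⊓ (ℚₚ.+-monoˡ-≤ z) t 1ℚ) ⟩
    ((t ℚ.+ z) ℚ.⊓ (1ℚ ℚ.+ z)) ℚ.⊓ 1ℚ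
      ≡⟨ ℚₚ.⊓-assoc (t ℚ.+ z) (1ℚ ℚ.+ z) 1ℚ ⟩
    (t ℚ.+ z) ℚ.⊓ ((1ℚ ℚ.+ z) ℚ.⊓ 1ℚ)
      ≡⟨ ≡.cong ((t ℚ.+ z) ℚ.⊓_) (ℚₚ.p≥q⇒p⊓q≡q (ℚₚ.+-monoʳ-≤ 1ℚ 0≤z)) ⟩
    (t ℚ.+ z) ℚ.⊓ 1ℚ ∎

  ⊕ℚ-comm : ∀ x y → x ⊕ℚ y ≡ y ⊕ℚ x
  ⊕ℚ-comm x y = ≡.cong (ℚ._⊓ 1ℚ) (ℚₚ.+-comm x y)

  ⊕ℚ-assoc : ∀ x y z → 0ℚ ℚ.≤ x → 0ℚ ℚ.≤ z → (x ⊕ℚ y) ⊕ℚ z ≡ x ⊕ℚ (y ⊕ℚ z)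
  ⊕ℚ-assoc x y z 0≤x 0≤z = begin
    (x ⊕ℚ y) ⊕ℚ z             ≡⟨ truncate (x ℚ.+ y) z 0≤z ⟩
    (x ℚ.+ y) ⊕ℚ z            ≡⟨ ≡.cong (ℚ._⊓ 1ℚ) (ℚₚ.+-assoc x y z) ⟩
    x ⊕ℚ (y ℚ.+ z)            ≡⟨ ⊕ℚ-comm x (y ℚ.+ z) ⟩
    (y ℚ.+ z) ⊕ℚ x            ≡⟨ truncate (y ℚ.+ z) x 0≤x ⟨
    (y ⊕ℚ z) ⊕ℚ x             ≡⟨ ⊕ℚ-comm (y ⊕ℚ z) x ⟩
    x ⊕ℚ (y ⊕ℚ z)             ∎

  ⊕ℚ-identityˡ : ∀ x → x ℚ.≤ 1ℚ → 0ℚ ⊕ℚ x ≡ x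
  ⊕ℚ-identityˡ x x≤1 = ≡.trans (≡.cong (ℚ._⊓ 1ℚ) (ℚₚ.+-identityˡ x)) (ℚₚ.p≤q⇒p⊓q≡p x≤1)

  sub-sub : ∀ x y → (1ℚ ℚ.- ((1ℚ ℚ.- x) ℚ.+ y)) ℚ.+ y ≡ x
  sub-sub x y = solve 2 (λ x y → (con 1ℚ :- ((con 1ℚ :- x) :+ y)) :+ y := x) ≡.refl x y
    where
    open import Data.Rational.Solver
    open +-*-Solver

  join : ∀ x y → x ℚ.≤ 1ℚ → y ℚ.≤ 1ℚ → (1ℚ ℚ.- ((1ℚ ℚ.- x) ⊕ℚ y)) ⊕ℚ y ≡ x ℚ.⊔ y
  join x y x≤1 y≤1 = begin
    f (((1ℚ ℚ.- x) ℚ.+ y) ℚ.⊓ 1ℚ) ℚ.⊓ 1ℚ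
      ≡⟨ ≡.cong (ℚ._⊓ 1ℚ) (ℚₚ.antimono-≤-distrib-⊓ {f} f-antimono ((1ℚ ℚ.- x) ℚ.+ y) 1ℚ) ⟩
    (f ((1ℚ ℚ.- x) ℚ.+ y) ℚ.⊔ f 1ℚ) ℚ.⊓ 1ℚ
      ≡⟨ ≡.cong (ℚ._⊓ 1ℚ) (≡.cong₂ ℚ._⊔_ (sub-sub x y) (ℚₚ.+-identityˡ y)) ⟩
    (x ℚ.⊔ y) ℚ.⊓ 1ℚ
      ≡⟨ ℚₚ.p≤q⇒p⊓q≡p (ℚₚ.⊔-lub x≤1 y≤1) ⟩
    x ℚ.⊔ y ∎
    where
    f : ℚ → ℚ
    f t = (1ℚ ℚ.- t) ℚ.+ y
    f-antimono : ∀ {s t} → s ℚ.≤ t → f t ℚ.≤ f s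
    f-antimono s≤t = ℚₚ.+-monoˡ-≤ y (ℚₚ.+-monoʳ-≤ 1ℚ (ℚₚ.neg-antimono-≤ s≤t))

  double-complement : ∀ x → 1ℚ ℚ.- (1ℚ ℚ.- x) ≡ x
  double-complement x = solve 1 (λ x → con 1ℚ :- (con 1ℚ :- x) := x) ≡.refl x
    where
    open import Data.Rational.Solver
    open +-*-Solver

[0,1]ℚ : MVAlgebra 0ℓ 0ℓ
[0,1]ℚ = record
  { Carrier             = Carrier
  ; _≈_                 = λ x y → proj₁ x ≡ proj₁ y
  ; _⊕_                 = _⊕_
  ; _*                  = _*
  ; 0#                  = 0ℚ , ℚₚ.≤-refl , 0≤1
  ; isCommutativeMonoid = record
    { isMonoid = record
      { isSemigroup = record
        { isMagma = record
          { isEquivalence = record { refl = ≡.refl ; sym = ≡.sym ; trans = ≡.trans }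
          ; ∙-cong        = ≡.cong₂ _⊕ℚ_
          }
        ; assoc = λ (x , 0≤x , _) (y , _) (z , 0≤z , _) → ⊕ℚ-assoc x y z 0≤x 0≤z
        }
      ; identity = (λ (x , _ , x≤1) → ⊕ℚ-identityˡ x x≤1)
                 , (λ (x , _ , x≤1) → ≡.trans (⊕ℚ-comm x 0ℚ) (⊕ℚ-identityˡ x x≤1))
      }
    ; comm = λ (x , _) (y , _) → ⊕ℚ-comm x y
    }
  ; *-cong              = ≡.cong (λ t → 1ℚ ℚ.- t)
  ; *-involutive        = λ (x , _) → double-complement x
  ; łukasiewicz         = λ (x , _ , x≤1) (y , _ , y≤1) →
      ≡.trans (join x y x≤1 y≤1) (≡.trans (ℚₚ.⊔-comm x y) (≡.sym (join y x y≤1 x≤1)))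
  ; ⊕-zeroˡ             = λ (x , 0≤x , _) → ℚₚ.p≥q⇒p⊓q≡q (ℚₚ.+-monoʳ-≤ 1ℚ 0≤x)
  }
  where open RationalInterval

record DivisionOperators (A : MVAlgebra c ℓ) : Set (c ⊔ ℓ) where
  open MVAlgebra A
  field
    δ      : (n : ℕ) .{{_ : NonZero n}} → Op₁ Carrier
    δ-cong : ∀ n .{{_ : NonZero n}} {x y} → x ≈ y → δ n x ≈ δ n y
    ·-δ    : ∀ n .{{_ : NonZero n}} x → n · δ n x ≈ x
    δ-⊥    : ∀ n .{{_ : NonZero n}} x → δ n x ⊙ (pred n · δ n x) ≈ 0#

record DMVAlgebra (c ℓ : Level) : Set (lsuc (c ⊔ ℓ)) where
  field
    mvAlgebra         : MVAlgebra c ℓ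
    divisionOperators : DivisionOperators mvAlgebra
  open MVAlgebra mvAlgebra public
  open DivisionOperators divisionOperators public

record DMVHomomorphism (A : DMVAlgebra a ℓ₁) (B : DMVAlgebra b ℓ₂)
       : Set (a ⊔ b ⊔ ℓ₁ ⊔ ℓ₂) where
  private
    module A = DMVAlgebra A
    module B = DMVAlgebra B
  field
    mvHomomorphism : MVHomomorphism A.mvAlgebra B.mvAlgebra
  open MVHomomorphism mvHomomorphism public
  field
    δ-homo : ∀ n .{{_ : NonZero n}} x → ⟦ A.δ n x ⟧ B.≈ B.δ n ⟦ x ⟧

record Category (o h e : Level) : Set (lsuc (o ⊔ h ⊔ e)) where
  infix  4 _⇒_ _≈_
  infixr 9 _∙_
  field
    Obj           : Set o
    _⇒_           : Obj → Obj → Set h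
    _≈_           : ∀ {X Y} → Rel (X ⇒ Y) e
    identity      : ∀ X → X ⇒ X
    _∙_           : ∀ {X Y Z} → Y ⇒ Z → X ⇒ Y → X ⇒ Z
    isEquivalence : ∀ {X Y} → IsEquivalence (_≈_ {X} {Y})
    ∙-cong        : ∀ {X Y Z} {f f′ : Y ⇒ Z} {g g′ : X ⇒ Y} →
                    f ≈ f′ → g ≈ g′ → f ∙ g ≈ f′ ∙ g′
    assoc         : ∀ {W X Y Z} (f : Y ⇒ Z) (g : X ⇒ Y) (k : W ⇒ X) →
                    (f ∙ g) ∙ k ≈ f ∙ (g ∙ k)
    identityˡ     : ∀ {X Y} (f : X ⇒ Y) → identity Y ∙ f ≈ f
    identityʳ     : ∀ {X Y} (f : X ⇒ Y) → f ∙ identity X ≈ f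

  homSetoid : Obj → Obj → Setoid h e
  homSetoid X Y = record { isEquivalence = isEquivalence {X} {Y} }

record Functor (𝒞 : Category o h e) (𝒟 : Category o′ h′ e′)
       : Set (o ⊔ h ⊔ e ⊔ o′ ⊔ h′ ⊔ e′) where
  private
    module 𝒞 = Category 𝒞
    module 𝒟 = Category 𝒟
  field
    F₀         : 𝒞.Obj → 𝒟.Obj
    F₁         : ∀ {X Y} → X 𝒞.⇒ Y → F₀ X 𝒟.⇒ F₀ Y
    F₁-cong    : ∀ {X Y} {f g : X 𝒞.⇒ Y} → f 𝒞.≈ g → F₁ f 𝒟.≈ F₁ g
    F-identity : ∀ X → F₁ (𝒞.identity X) 𝒟.≈ 𝒟.identity (F₀ X)
    F-∙        : ∀ {X Y Z} (f : Y 𝒞.⇒ Z) (g : X 𝒞.⇒ Y) →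
                 F₁ (f 𝒞.∙ g) 𝒟.≈ F₁ f 𝒟.∙ F₁ g

infix 4 _⊣_

record _⊣_ {𝒞 : Category o h e} {𝒟 : Category o′ h′ e′}
           (L : Functor 𝒞 𝒟) (R : Functor 𝒟 𝒞)
       : Set (o ⊔ h ⊔ e ⊔ o′ ⊔ h′ ⊔ e′) where
  private
    module 𝒞 = Category 𝒞
    module 𝒟 = Category 𝒟
    module L = Functor L
    module R = Functor R
  field
    hom-iso : ∀ X Y → Inverse (𝒟.homSetoid (L.F₀ X) Y) (𝒞.homSetoid X (R.F₀ Y))
    natural : ∀ {X X′ Y Y′} (f : X′ 𝒞.⇒ X) (g : Y 𝒟.⇒ Y′) (k : L.F₀ X 𝒟.⇒ Y) →
              Inverse.to (hom-iso X′ Y′) (g 𝒟.∙ k 𝒟.∙ L.F₁ f)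
                𝒞.≈ R.F₁ g 𝒞.∙ Inverse.to (hom-iso X Y) k 𝒞.∙ f

module _ {A : MVAlgebra a ℓ₁} {B : MVAlgebra b ℓ₂} where

  infix 4 _≗MV_

  _≗MV_ : Rel (MVHomomorphism A B) (a ⊔ ℓ₂)
  f ≗MV g = ∀ x → MVHomomorphism.⟦_⟧ f x ≈ MVHomomorphism.⟦_⟧ g x
    where open MVAlgebra B

idMV : (A : MVAlgebra a ℓ₁) → MVHomomorphism A A
idMV A = record
  { ⟦_⟧ = id ; cong = id ; ⊕-homo = λ _ _ → refl ; *-homo = λ _ → refl ; 0-homo = refl }
  where open MVAlgebra A

infixr 9 _∘MV_

_∘MV_ : {A : MVAlgebra a ℓ₁} {B : MVAlgebra b ℓ₂} {C : MVAlgebra c ℓ₃} →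
        MVHomomorphism B C → MVHomomorphism A B → MVHomomorphism A C
_∘MV_ {C = C} f g = record
  { ⟦_⟧    = f.⟦_⟧ ∘ g.⟦_⟧
  ; cong   = f.cong ∘ g.cong
  ; ⊕-homo = λ x y → trans (f.cong (g.⊕-homo x y)) (f.⊕-homo _ _)
  ; *-homo = λ x → trans (f.cong (g.*-homo x)) (f.*-homo _)
  ; 0-homo = trans (f.cong g.0-homo) f.0-homo
  }
  where
  open MVAlgebra C
  module f = MVHomomorphism f
  module g = MVHomomorphism g

record SemisimpleMVAlgebra (c ℓ p : Level) : Set (lsuc (c ⊔ ℓ ⊔ p)) where
  field
    mvAlgebra  : MVAlgebra c ℓ
    semisimple : Semisimple p mvAlgebra

record SemisimpleDMVAlgebra (c ℓ p : Level) : Set (lsuc (c ⊔ ℓ ⊔ p)) where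
  field
    dmvAlgebra : DMVAlgebra c ℓ
    semisimple : Semisimple p (DMVAlgebra.mvAlgebra dmvAlgebra)

-- Equality takes values in Set (c ⊔ lsuc p): the radical quantifies over ideals
-- valued in Set p, so this is the universe of the equality of a quotient by Rad.
MVss : (c p : Level) → Category (lsuc (c ⊔ lsuc p)) (c ⊔ lsuc p) (c ⊔ lsuc p)
MVss c p = record
  { Obj           = SemisimpleMVAlgebra c (c ⊔ lsuc p) p
  ; _⇒_           = λ A B → MVHomomorphism (mvAlgebra A) (mvAlgebra B)
  ; _≈_           = _≗MV_
  ; identity      = λ A → idMV (mvAlgebra A)
  ; _∙_           = _∘MV_
  ; isEquivalence = λ {A} {B} → let open MVAlgebra (mvAlgebra B) in record
      { refl = λ _ → refl ; sym = λ q x → sym (q x) ; trans = λ q r x → trans (q x) (r x) }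
  ; ∙-cong        = λ {X} {Y} {Z} {f} {f′} {g} {g′} q r x →
      MVAlgebra.trans (mvAlgebra Z) (MVHomomorphism.cong f (r x)) (q _)
  ; assoc         = λ {_} {_} {_} {Z} _ _ _ _ → MVAlgebra.refl (mvAlgebra Z)
  ; identityˡ     = λ {_} {Y} _ _ → MVAlgebra.refl (mvAlgebra Y)
  ; identityʳ     = λ {_} {Y} _ _ → MVAlgebra.refl (mvAlgebra Y)
  }
  where open SemisimpleMVAlgebra

DMVss : (c p : Level) → Category (lsuc (c ⊔ lsuc p)) (c ⊔ lsuc p) (c ⊔ lsuc p)
DMVss c p = record
  { Obj           = SemisimpleDMVAlgebra c (c ⊔ lsuc p) p
  ; _⇒_           = λ A B → DMVHomomorphism (dmvAlgebra A) (dmvAlgebra B)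
  ; _≈_           = λ f g → mvHomomorphism f ≗MV mvHomomorphism g
  ; identity      = λ A → record
      { mvHomomorphism = idMV (mvAlgebra (dmvAlgebra A))
      ; δ-homo         = λ _ _ → DMVAlgebra.refl (dmvAlgebra A)
      }
  ; _∙_           = λ {_} {_} {Z} f g → record
      { mvHomomorphism = mvHomomorphism f ∘MV mvHomomorphism g
      ; δ-homo         = λ n x → DMVAlgebra.trans (dmvAlgebra Z)
          (DMVHomomorphism.cong f (DMVHomomorphism.δ-homo g n x))
          (DMVHomomorphism.δ-homo f n _)
      }
  ; isEquivalence = λ {A} {B} → let open DMVAlgebra (dmvAlgebra B) in record
      { refl = λ _ → refl ; sym = λ q x → sym (q x) ; trans = λ q r x → trans (q x) (r x) }
  ; ∙-cong        = λ {X} {Y} {Z} {f} {f′} {g} {g′} q r x →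
      DMVAlgebra.trans (dmvAlgebra Z) (DMVHomomorphism.cong f (r x)) (q _)
  ; assoc         = λ {_} {_} {_} {Z} _ _ _ _ → DMVAlgebra.refl (dmvAlgebra Z)
  ; identityˡ     = λ {_} {Y} _ _ → DMVAlgebra.refl (dmvAlgebra Y)
  ; identityʳ     = λ {_} {Y} _ _ → DMVAlgebra.refl (dmvAlgebra Y)
  }
  where
  open SemisimpleDMVAlgebra
  open DMVAlgebra using (mvAlgebra)
  open DMVHomomorphism using (mvHomomorphism)

𝒰δ : (c p : Level) → Functor (DMVss c p) (MVss c p)
𝒰δ c p = record
  { F₀         = λ A → record
      { mvAlgebra  = DMVAlgebra.mvAlgebra (SemisimpleDMVAlgebra.dmvAlgebra A)
      ; semisimple = SemisimpleDMVAlgebra.semisimple A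
      }
  ; F₁         = DMVHomomorphism.mvHomomorphism
  ; F₁-cong    = id
  ; F-identity = λ A _ → DMVAlgebra.refl (SemisimpleDMVAlgebra.dmvAlgebra A)
  ; F-∙        = λ {_} {_} {Z} _ _ _ → DMVAlgebra.refl (SemisimpleDMVAlgebra.dmvAlgebra Z)
  }

[0,1]ℚ⊗_ : SemisimpleMVAlgebra c (c ⊔ lsuc p) p → MVAlgebra c (c ⊔ lsuc p)
[0,1]ℚ⊗_ {p = p} B = [0,1]ℚ ⊗[ p ] SemisimpleMVAlgebra.mvAlgebra B

ι : (B : SemisimpleMVAlgebra c (c ⊔ lsuc p) p) →
    MVAlgebra.Carrier (SemisimpleMVAlgebra.mvAlgebra B) → MVAlgebra.Carrier ([0,1]ℚ⊗ B)
ι B b = MVAlgebra.1# [0,1]ℚ ⊗ₜ b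
  where open MVTensor [0,1]ℚ (SemisimpleMVAlgebra.mvAlgebra B)

divisible : (B : SemisimpleMVAlgebra c (c ⊔ lsuc p) p) →
            DivisionOperators ([0,1]ℚ⊗ B) → SemisimpleDMVAlgebra c (c ⊔ lsuc p) p
divisible {p = p} B δs = record
  { dmvAlgebra = record { mvAlgebra = [0,1]ℚ⊗ B ; divisionOperators = δs }
  ; semisimple = /Rad-semisimple ([0,1]ℚ ⊗MV SemisimpleMVAlgebra.mvAlgebra B) p
  }

-- The data of 𝒟⊗: the division operators of [0,1]ℚ ⊗ B, of which an MV-algebra
-- has at most one family, and the unique homomorphisms f̃ with f̃ ∘ ι = ι ∘ f.
record DivisibleTensor (c p : Level) : Set (lsuc (c ⊔ lsuc p)) where
  private
    module MV  = Category (MVss c p)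
    module DMV = Category (DMVss c p)

  field
    divisionOperators : ∀ B → DivisionOperators ([0,1]ℚ⊗ B)

  𝒟₀ : MV.Obj → DMV.Obj
  𝒟₀ B = divisible B (divisionOperators B)

  Extends : ∀ A B → 𝒟₀ A DMV.⇒ 𝒟₀ B → A MV.⇒ B → Set (c ⊔ lsuc p)
  Extends A B g f = ∀ a →
    MVAlgebra._≈_ ([0,1]ℚ⊗ B) (DMVHomomorphism.⟦_⟧ g (ι A a)) (ι B (MVHomomorphism.⟦_⟧ f a))

  field
    tilde         : ∀ A B → A MV.⇒ B → 𝒟₀ A DMV.⇒ 𝒟₀ B
    tilde-extends : ∀ A B (f : A MV.⇒ B) → Extends A B (tilde A B f) f
    tilde-unique  : ∀ A B (f : A MV.⇒ B) (g : 𝒟₀ A DMV.⇒ 𝒟₀ B) →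
                    Extends A B g f → DMV._≈_ {𝒟₀ A} {𝒟₀ B} g (tilde A B f)

  private
    ι-cong : ∀ B {x y} → let open MVAlgebra in
             _≈_ (SemisimpleMVAlgebra.mvAlgebra B) x y → _≈_ ([0,1]ℚ⊗ B) (ι B x) (ι B y)
    ι-cong B q = Quotient.≈⇒∼ ([0,1]ℚ ⊗MV B.mvAlgebra) (Rad p _)
                   (MVTensor.⊗-congₜ ≡.refl q)
      where module B = SemisimpleMVAlgebra B

  𝒟⊗ : Functor (MVss c p) (DMVss c p)
  𝒟⊗ = record
    { F₀         = 𝒟₀
    ; F₁         = λ {A} {B} → tilde A B
    ; F₁-cong    = λ {A} {B} {f} {g} f≈g → tilde-unique A B g (tilde A B f) λ a →
        MVAlgebra.trans ([0,1]ℚ⊗ B) (tilde-extends A B f a) (ι-cong B (f≈g a))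
    ; F-identity = λ A x → MVAlgebra.sym ([0,1]ℚ⊗ A)
        (tilde-unique A A (MV.identity A) (DMV.identity (𝒟₀ A))
          (λ _ → MVAlgebra.refl ([0,1]ℚ⊗ A)) x)
    ; F-∙        = λ {A} {B} {C} f g x → MVAlgebra.sym ([0,1]ℚ⊗ C)
        (tilde-unique A C (MV._∙_ {A} {B} {C} f g)
          (DMV._∙_ {𝒟₀ A} {𝒟₀ B} {𝒟₀ C} (tilde B C f) (tilde A B g))
          (λ a → MVAlgebra.trans ([0,1]ℚ⊗ C)
            (DMVHomomorphism.cong (tilde B C f) (tilde-extends A B g a))
            (tilde-extends B C f _))
          x)
    }

{-# OPTIONS --safe #-}
module Submission where

-- A maximal ideal I has ¬¬-stable membership, because {x | ¬¬ (x ∈ I)} is again a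
-- proper ideal, and it is prime, because for b ∉ I the ideal {x | x ∧ b ∈ I} is
-- proper.  Quotients by maximal ideals are therefore chains in which equations may
-- be proved by cases, and a semisimple algebra satisfies every equation that holds
-- in them; in particular n-th parts are unique in it.  On terms of [0,1]ℚ ⊗ B
-- division by n is given by structural recursion.  A homomorphism f from B to a
-- semisimple DMV-algebra extends along ι through the bimorphism
-- (m/n , b) ↦ m · δ n (f b); the extension is constant modulo the radical since
-- preimages of maximal ideals are maximal, and it is unique because (m/n) ⊗ b is
-- m times the n-th part of ι b.

open import Algebra.Bundles using (CommutativeMonoid)
import Algebra.Properties.CommutativeMonoid.Mult as Multiples
import Algebra.Properties.CommutativeSemigroup as CommutativeSemigroupProperties
open import Data.Integer.Base as ℤ using (+_; ∣_∣)
import Data.Integer.Properties as ℤₚ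
open import Data.Nat.Base as ℕ using (ℕ; zero; suc; pred; NonZero; z≤n; s≤s)
import Data.Nat.Properties as ℕₚ
open import Data.Nat.Solver using (module +-*-Solver)
open import Data.Product.Base using (Σ-syntax; _×_; _,_; proj₁)
open import Data.Rational as ℚ using (ℚ; 0ℚ; 1ℚ; ↥_; ↧ₙ_)
import Data.Rational.Properties as ℚₚ
import Data.Rational.Solver as ℚ-Solver
open import Data.Rational.Unnormalised.Base as ℚᵘ using (mkℚᵘ; *≡*; *≤*)
import Data.Rational.Unnormalised.Properties as ℚᵘₚ
open import Data.Sum.Base as Sum using (_⊎_; inj₁; inj₂)
open import Function.Base using (id)
open import Function.Bundles using (Inverse)
open import Level using (Level; _⊔_) renaming (suc to lsuc)
open import Relation.Binary.PropositionalEquality as ≡ using (_≡_)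
import Relation.Binary.Reasoning.Setoid as SetoidReasoning
open import Relation.Nullary using (¬_)
open import Relation.Unary using (_∈_)
open import Defs

open Ideal using (Member)

private
  variable
    a b b′ c p ℓ ℓ₁ ℓ₂ ℓ₂′ ℓ₃ : Level

-- Order, lattice structure and truncated difference in an MV-algebra.

module MVOrder (A : MVAlgebra a ℓ) where
  open MVAlgebra A public
  open MVProperties A public
  open SetoidReasoning setoid
  open Multiples commutativeMonoid public
    using () renaming (×-congʳ to ·-congʳ; ×-congˡ to ·-congˡ; ×-homo-+ to ·-homo-+
                      ; ×-assocˡ to ·-assocˡ; ×-distrib-+ to ·-distrib-⊕)
  open CommutativeSemigroupProperties
    (CommutativeMonoid.commutativeSemigroup commutativeMonoid) public
    using (x∙yz≈y∙xz)

  ≤-refl : ∀ {x} → x ≤ x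
  ≤-refl = ≤-reflexive refl

  ≤-antisym : ∀ {x y} → x ≤ y → y ≤ x → x ≈ y
  ≤-antisym {x} {y} x≤y y≤x = sym (begin
    y                ≈⟨ difference x≤y ⟩
    x ⊕ (y * ⊕ x) *  ≈⟨ ⊕-congˡ (trans (*-cong y≤x) (*-involutive 0#)) ⟩
    x ⊕ 0#           ≈⟨ ⊕-identityʳ x ⟩
    x                ∎)

  0≤x : ∀ x → 0# ≤ x
  0≤x = ⊕-zeroˡ

  x≤1 : ∀ x → x ≤ 1#
  x≤1 x = ⊕-zeroʳ (x *)

  *-antimono : ∀ {x y} → x ≤ y → y * ≤ x *
  *-antimono x≤y = trans (⊕-comm _ _) (trans (⊕-congˡ (*-involutive _)) x≤y)

  unresidual : ∀ {x y z} → x ⊙ y * ≤ z → x ≤ y ⊕ z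
  unresidual {x} {y} {z} = trans (sym (residual-eq x y z))

  x⊖y≤x : ∀ x y → x ⊙ y * ≤ x
  x⊖y≤x x y = residual (x≤y⊕x x y)

  x⊖y≈0⇒x≤y : ∀ {x y} → x ⊙ y * ≈ 0# → x ≤ y
  x⊖y≈0⇒x≤y {x} {y} q = ≤-respʳ (⊕-identityʳ y) (unresidual (≤-reflexive q))

  d≈0⇒x≈y : ∀ {x y} → d x y ≈ 0# → x ≈ y
  d≈0⇒x≈y q = ≤-antisym (x⊖y≈0⇒x≤y (zero-below (x≤x⊕y _ _)))
                        (x⊖y≈0⇒x≤y (zero-below (x≤y⊕x _ _)))
    where
    zero-below : ∀ {x} → x ≤ d _ _ → x ≈ 0#
    zero-below r = ≤-antisym (≤-respʳ q r) (0≤x _)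

  y≤x∨y : ∀ x y → y ≤ x ∨ y
  y≤x∨y x y = x≤y⊕x y _

  x≤x∨y : ∀ x y → x ≤ x ∨ y
  x≤x∨y x y = ≤-respʳ (⊕-comm _ _) (x≤y⊕[x⊖y] x y)

  -- Since `y ≤ z`, `z` is `(z ⊙ y *) ⊕ y`, and the truncated difference is monotone in its first
  -- argument.
  ∨-lub : ∀ {x y z} → x ≤ z → y ≤ z → x ∨ y ≤ z
  ∨-lub {x} {y} {z} x≤z y≤z =
    ≤-respʳ (sym (trans (difference y≤z)
                   (trans (⊕-comm _ _) (⊕-congʳ (*-cong (⊕-congˡ (sym (*-involutive y))))))))
            (⊕-mono-≤ (residual (≤-trans x≤z (x≤y⊕[x⊖y] z y))) ≤-refl)

  ∧-deMorgan : ∀ x y → (x * ∨ y *) * ≈ x ∧ y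
  ∧-deMorgan x y = *-cong (⊕-congʳ (*-cong (⊕-cong (*-involutive x) (*-involutive (y *)))))

  x∧y≤x : ∀ x y → x ∧ y ≤ x
  x∧y≤x x y = ≤-respˡ (∧-deMorgan x y) (≤-respʳ (*-involutive x) (*-antimono (x≤x∨y _ _)))

  x∧y≤y : ∀ x y → x ∧ y ≤ y
  x∧y≤y x y = ≤-respˡ (∧-deMorgan x y) (≤-respʳ (*-involutive y) (*-antimono (y≤x∨y _ _)))

  ∧-glb : ∀ {x y z} → z ≤ x → z ≤ y → z ≤ x ∧ y
  ∧-glb {x} {y} {z} z≤x z≤y = ≤-respˡ (*-involutive z)
    (≤-respʳ (∧-deMorgan x y) (*-antimono (∨-lub (*-antimono z≤x) (*-antimono z≤y))))

  ∧-cong : ∀ {x x′ y y′} → x ≈ x′ → y ≈ y′ → x ∧ y ≈ x′ ∧ y′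
  ∧-cong q r = ⊙-cong (⊕-cong q (*-cong r)) r

  ∨-cong : ∀ {x x′ y y′} → x ≈ x′ → y ≈ y′ → x ∨ y ≈ x′ ∨ y′
  ∨-cong q r = ⊕-cong (⊙-cong q (*-cong r)) r

  x≤y⇒x∧y≈x : ∀ {x y} → x ≤ y → x ∧ y ≈ x
  x≤y⇒x∧y≈x x≤y = ≤-antisym (x∧y≤x _ _) (∧-glb ≤-refl x≤y)

  y≤x⇒x∧y≈y : ∀ {x y} → y ≤ x → x ∧ y ≈ y
  y≤x⇒x∧y≈y y≤x = ≤-antisym (x∧y≤y _ _) (∧-glb y≤x ≤-refl)

  x≤y⇒x∨y≈y : ∀ {x y} → x ≤ y → x ∨ y ≈ y
  x≤y⇒x∨y≈y x≤y = ≤-antisym (∨-lub x≤y ≤-refl) (y≤x∨y _ _)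

  y≤x⇒x∨y≈x : ∀ {x y} → y ≤ x → x ∨ y ≈ x
  y≤x⇒x∨y≈x y≤x = ≤-antisym (∨-lub ≤-refl y≤x) (x≤x∨y _ _)

  ∧-comm : ∀ x y → x ∧ y ≈ y ∧ x
  ∧-comm x y = ≤-antisym (∧-glb (x∧y≤y x y) (x∧y≤x x y)) (∧-glb (x∧y≤y y x) (x∧y≤x y x))

  x⊖y⊕x∧y≈x : ∀ x y → (x ⊙ y *) ⊕ (x ∧ y) ≈ x
  x⊖y⊕x∧y≈x x y = sym (trans (difference (x⊖y≤x x y)) (⊕-congˡ (begin
    (x * ⊕ x ⊙ y *) *           ≈⟨ *-cong (⊕-comm _ _) ⟩
    (x ⊙ y * ⊕ x *) *           ≈⟨ *-cong (⊕-congʳ (*-cong (trans (⊕-comm _ _)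
                                                       (⊕-congʳ (*-involutive y))))) ⟩
    y ∧ x                       ≈⟨ ∧-comm y x ⟩
    x ∧ y                       ∎)))

  -- Residuation moves one summand at a time to the left, so that each meet on the right can be
  -- entered by `∧-glb`. This makes ideal quotients closed under sums.
  ∧-sub-⊕ : ∀ x y z → (x ⊕ y) ∧ z ≤ (x ∧ z) ⊕ (y ∧ z)
  ∧-sub-⊕ x y z = unresidual (∧-glb (residual ≤[x∧z]⊕y) (residual ≤⊕z))
    where
    ≤⊕z : ∀ {w} → (x ⊕ y) ∧ z ≤ w ⊕ z
    ≤⊕z = ≤-trans (x∧y≤y _ _) (x≤y⊕x _ _)
    ≤[x∧z]⊕y : (x ⊕ y) ∧ z ≤ (x ∧ z) ⊕ y
    ≤[x∧z]⊕y = ≤-respʳ (⊕-comm _ _)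
      (unresidual (∧-glb (residual (≤-respʳ (⊕-comm x y) (x∧y≤x _ _))) (residual ≤⊕z)))

  -- Orthogonality and partial sums.

  ⊥⇒≤* : ∀ {x y} → x ⊥ y → x ≤ y *
  ⊥⇒≤* q = trans (sym (*-involutive _)) (*-cong q)

  ≤*⇒⊥ : ∀ {x y} → x ≤ y * → x ⊥ y
  ≤*⇒⊥ q = trans (*-cong q) (*-involutive 0#)

  ⊥-sym : ∀ {x y} → x ⊥ y → y ⊥ x
  ⊥-sym = trans (⊙-comm _ _)

  ⊥-mono : ∀ {x x′ y y′} → x ≤ x′ → y ≤ y′ → x′ ⊥ y′ → x ⊥ y
  ⊥-mono q r s = ≤*⇒⊥ (≤-trans q (≤-trans (⊥⇒≤* s) (*-antimono r)))

  ⊥-resp-≈ : ∀ {x x′ y y′} → x ≈ x′ → y ≈ y′ → x ⊥ y → x′ ⊥ y′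
  ⊥-resp-≈ q r = trans (sym (⊙-cong q r))

  x⊥x* : ∀ x → x ⊥ x *
  x⊥x* x = ≤*⇒⊥ (≤-reflexive (sym (*-involutive x)))

  x⊥y⊖x : ∀ x y → x ⊥ (y ⊙ x *)
  x⊥y⊖x x y = ⊥-mono ≤-refl (≤-respˡ (⊙-comm _ _) x*⊙y≤x*) (x⊥x* x)
    where
    x*⊙y≤x* : x * ⊙ y ≤ x *
    x*⊙y≤x* = ≤-respˡ (⊙-cong refl (*-involutive y)) (x⊖y≤x (x *) (y *))

  0⊥x : ∀ x → 0# ⊥ x
  0⊥x x = ≤*⇒⊥ (0≤x _)

  -- Subtracting `z` from `x ⊕ z` yields `x ∧ z *`, which is no smaller than `x` when the sum is
  -- defined.
  ⊕-cancelʳ-≤ : ∀ {x y z} → x ⊥ z → x ⊕ z ≤ y ⊕ z → x ≤ y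
  ⊕-cancelʳ-≤ {x} {y} {z} x⊥z q = ≤-trans x≤[x⊕z]⊖z
    (residual (≤-trans q (≤-reflexive (⊕-comm y z))))
    where
    x≤[x⊕z]⊖z : x ≤ (x ⊕ z) ⊙ z *
    x≤[x⊕z]⊖z = ≤-respʳ (⊙-cong (⊕-congˡ (*-involutive z)) refl) (∧-glb ≤-refl (⊥⇒≤* x⊥z))

  -- Here `x *` splits as `y ⊕ (x ⊕ y) *`, and `z` lies below the second summand.
  ⊥-assoc : ∀ {x y z} → x ⊥ y → (x ⊕ y) ⊥ z → x ⊥ (y ⊕ z)
  ⊥-assoc {x} {y} {z} x⊥y q = ⊥-sym (≤*⇒⊥ (≤-respʳ (sym (difference (⊥⇒≤* (⊥-sym x⊥y))))
    (⊕-mono-≤ ≤-refl (≤-respʳ (*-cong (⊕-congʳ (sym (*-involutive x)))) (⊥⇒≤* (⊥-sym q))))))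

  ⊥-interchange : ∀ {x x′ y y′} → x ⊥ x′ → y ⊥ y′ → (x ⊕ x′) ⊥ (y ⊕ y′) →
                  (x ⊕ y) ⊥ (x′ ⊕ y′)
  ⊥-interchange {x} {x′} {y} {y′} x⊥x′ y⊥y′ q =
    ⊥-resp-≈ (⊕-comm _ _) refl (⊥-sym (⊥-assoc (⊥-sym y⊥x′⊕y′)
      (⊥-resp-≈ (trans (x∙yz≈y∙xz x′ y y′) (⊕-comm _ _)) refl (⊥-sym (⊥-assoc x⊥x′ q)))))
    where
    y⊥x′⊕y′ : y ⊥ (x′ ⊕ y′)
    y⊥x′⊕y′ = ⊥-resp-≈ refl (⊕-comm _ _)
      (⊥-assoc y⊥y′ (⊥-mono ≤-refl (x≤y⊕x x′ x) (⊥-sym q)))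

  complement : ∀ {x y} → x ⊥ y → x ⊕ y ≈ 1# → y ≈ x *
  complement x⊥y q = ≤-antisym (⊥⇒≤* (⊥-sym x⊥y)) (trans (⊕-congʳ (*-involutive _)) q)

  -- The difference `(x ⊕ y) ⊙ x *` lies below both `x *` and `y`.
  ⊕-as-+ : ∀ x y → x ⊕ (x * ∧ y) ≈ x ⊕ y
  ⊕-as-+ x y = ≤-antisym (⊕-mono-≤ ≤-refl (x∧y≤y _ y))
    (unresidual (∧-glb (≤-respˡ (⊙-comm _ _)
      (≤-respˡ (⊙-cong refl (*-involutive _)) (x⊖y≤x _ _))) (residual ≤-refl)))

  -- The meet `t` of the two differences is orthogonal to `x ∧ y`, and `t ⊕ (x ∧ y)` is below both
  -- `x` and `y`, hence below `x ∧ y`. Cancelling `x ∧ y` leaves `t ≤ 0#`.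
  prelinear : ∀ x y → (x ⊙ y *) ∧ (y ⊙ x *) ≈ 0#
  prelinear x y = ≤-antisym (⊕-cancelʳ-≤ t⊥x∧y
    (≤-respʳ (sym (⊕-identityˡ _)) (∧-glb (below (x∧y≤x _ _) (x⊖y⊕x∧y≈x x y))
      (below (x∧y≤y _ _) (trans (⊕-congˡ (∧-comm x y)) (x⊖y⊕x∧y≈x y x)))))) (0≤x _)
    where
    below : ∀ {s t u v} → s ≤ t → t ⊕ u ≈ v → s ⊕ u ≤ v
    below s≤t q = ≤-respʳ q (⊕-mono-≤ s≤t ≤-refl)
    t⊥x∧y : ((x ⊙ y *) ∧ (y ⊙ x *)) ⊥ (x ∧ y)
    t⊥x∧y = ⊥-mono (x∧y≤x _ _) (x∧y≤y x y) (⊥-sym (x⊥y⊖x y x))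

  -- Multiples and n-th parts.

  ·-mono : ∀ n {x y} → x ≤ y → n · x ≤ n · y
  ·-mono zero    _ = ≤-refl
  ·-mono (suc n) q = ⊕-mono-≤ q (·-mono n q)

  ·-monoˡ : ∀ {m n} x → m ℕ.≤ n → m · x ≤ n · x
  ·-monoˡ x z≤n     = 0≤x _
  ·-monoˡ x (s≤s q) = ⊕-mono-≤ ≤-refl (·-monoˡ x q)

  -- The n-fold partial sum x + ⋯ + x is defined, making x an n-th part of n · x.
  Summable : ℕ → Carrier → Set ℓ
  Summable n x = x ⊥ (pred n · x)

  -- Induction on `j`: one copy of `x` is orthogonal to `(j + k) · x` by summability, and `⊥-assoc`
  -- transfers it to the side of `j · x`.
  summable⇒⊥ : ∀ {n} j k {x} → Summable n x → j ℕ.+ k ℕ.≤ n → (j · x) ⊥ (k · x)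
  summable⇒⊥ zero k _ _ = 0⊥x _
  summable⇒⊥ {suc n} (suc j) k {x} s (s≤s q) = ⊥-sym (⊥-resp-≈ refl (⊕-comm _ _)
    (⊥-assoc (⊥-sym (summable⇒⊥ j k s (ℕₚ.m≤n⇒m≤1+n q)))
      (⊥-sym (⊥-mono ≤-refl
        (≤-respˡ (trans (·-homo-+ x j k) (⊕-comm _ _)) (·-monoˡ x q)) s))))

  summable-mono : ∀ n {x y} → x ≤ y → Summable n y → Summable n x
  summable-mono n q = ⊥-mono q (·-mono (pred n) q)

  summable-cong : ∀ n {x y} → x ≈ y → Summable n x → Summable n y
  summable-cong n q = ⊥-resp-≈ q (·-congʳ (pred n) q)

  summable-⊕ : ∀ n {x y} → Summable n x → Summable n y → (n · x) ⊥ (n · y) →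
               Summable n (x ⊕ y)
  summable-⊕ zero          _ _ _ = ⊥-sym (0⊥x _)
  summable-⊕ (suc n) {x} {y} s t q = ⊥-resp-≈ refl (sym (·-distrib-⊕ x y n)) (⊥-interchange s t q)

  summable⇒multiples-⊥ : ∀ {n} k {x y} → x ⊥ y → Summable n (x ⊕ y) → k ℕ.≤ n →
                         (k · x) ⊥ (k · y)
  summable⇒multiples-⊥ zero    _   _ _ = 0⊥x _
  summable⇒multiples-⊥ {suc n} (suc k) {x} {y} x⊥y s (s≤s q) =
    ⊥-interchange x⊥y (summable⇒multiples-⊥ k x⊥y s (ℕₚ.m≤n⇒m≤1+n q))
      (⊥-resp-≈ refl (·-distrib-⊕ x y k) (⊥-mono ≤-refl (·-monoˡ _ q) s))

  summable-· : ∀ m n {x} → Summable (m ℕ.* n) x → Summable m (n · x)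
  summable-· zero    n _ = ⊥-sym (0⊥x _)
  summable-· (suc m) n s = ⊥-resp-≈ refl (sym (·-assocˡ _ m n)) (summable⇒⊥ n (m ℕ.* n) s ℕₚ.≤-refl)

  -- Multiplying the partial sum `u = x + (u ⊙ x *)` by `n` gives a partial sum equal to `1#`, and
  -- complements are unique. With `u` as 1/n this is the division of a negation.
  summable-complement : ∀ n {u x} → Summable n u → n · u ≈ 1# → x ≤ u →
                        n · (u ⊙ x *) ≈ (n · x) *
  summable-complement n {u} {x} s nu≈1 x≤u = complement
    (summable⇒multiples-⊥ n (x⊥y⊖x x u) (summable-cong n u≈ s) ℕₚ.≤-refl)
    (trans (sym (·-distrib-⊕ x _ n)) (trans (·-congʳ n (sym u≈)) nu≈1))
    where
    u≈ : u ≈ x ⊕ (u ⊙ x *)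
    u≈ = trans (difference x≤u) (⊕-congˡ (*-cong (⊕-congˡ (sym (*-involutive x)))))

-- Chains with stable equality.

-- A constructive substitute for a linear order: no comparison is decided, but stability of
-- equations makes a case distinction on the order legitimate when proving one.
record IsStableChain (A : MVAlgebra a ℓ) : Set (a ⊔ ℓ) where
  open MVAlgebra A
  field
    total  : ∀ {x y} → ¬ (x ≤ y) → y ≤ x
    stable : ∀ {x y} → ¬ ¬ (x ≈ y) → x ≈ y

  by-comparison : ∀ x y {u v} → (x ≤ y → u ≈ v) → (y ≤ x → u ≈ v) → u ≈ v
  by-comparison x y q r = stable λ u≉v → u≉v (r (total λ x≤y → u≉v (q x≤y)))

module StableChainProperties (A : MVAlgebra a ℓ) (isStableChain : IsStableChain A) where
  open MVOrder A
  open IsStableChain isStableChain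

  -- From `y ≤ x`, the right-hand multiple is at most `y ⊕ (pred n · x)`, and summability allows
  -- `pred n · x` to be cancelled.
  part-reflects-≤ : ∀ n .{{_ : NonZero n}} {x y} → Summable n x → y ≤ x →
                    n · x ≤ n · y → x ≤ y
  part-reflects-≤ (suc n) s y≤x q =
    ⊕-cancelʳ-≤ s (≤-trans q (⊕-mono-≤ ≤-refl (·-mono n y≤x)))

  part-unique : ∀ n .{{_ : NonZero n}} {x y} → Summable n x → Summable n y →
                n · x ≈ n · y → x ≈ y
  part-unique n {x} {y} s t q = by-comparison x y
    (λ x≤y → ≤-antisym x≤y (part-reflects-≤ n t x≤y (≤-reflexive (sym q))))
    (λ y≤x → ≤-antisym (part-reflects-≤ n s y≤x (≤-reflexive q)) y≤x)

  -- In a chain the join is one of its arguments, so `w` coincides with `x` or with `y` by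
  -- uniqueness of parts. The free multiplier `k` later becomes the numerator of a fraction.
  part-∨ : ∀ n .{{_ : NonZero n}} k {w x y} → Summable n w → Summable n x → Summable n y →
           n · w ≈ n · x ∨ n · y → k · w ≈ k · x ∨ k · y
  part-∨ n k {w} {x} {y} r s t q = by-comparison x y
    (λ x≤y → trans (·-congʳ k (part-unique n r t (trans q (x≤y⇒x∨y≈y (·-mono n x≤y)))))
                   (sym (x≤y⇒x∨y≈y (·-mono k x≤y))))
    (λ y≤x → trans (·-congʳ k (part-unique n r s (trans q (y≤x⇒x∨y≈x (·-mono n y≤x)))))
                   (sym (y≤x⇒x∨y≈x (·-mono k y≤x))))

  part-∧ : ∀ n .{{_ : NonZero n}} k {w x y} → Summable n w → Summable n x → Summable n y →
           n · w ≈ n · x ∧ n · y → k · w ≈ k · x ∧ k · y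
  part-∧ n k {w} {x} {y} r s t q = by-comparison x y
    (λ x≤y → trans (·-congʳ k (part-unique n r s (trans q (x≤y⇒x∧y≈x (·-mono n x≤y)))))
                   (sym (x≤y⇒x∧y≈x (·-mono k x≤y))))
    (λ y≤x → trans (·-congʳ k (part-unique n r t (trans q (y≤x⇒x∧y≈y (·-mono n y≤x)))))
                   (sym (y≤x⇒x∧y≈y (·-mono k y≤x))))

  -- Truncation at `u` changes something only when `u ≤ x`, and then both multiples are already
  -- `1#`.
  ·-∧-unit : ∀ n x {u} → n · u ≈ 1# → n · (x ∧ u) ≈ n · x
  ·-∧-unit n x {u} q = by-comparison x u
    (λ x≤u → ·-congʳ n (x≤y⇒x∧y≈x x≤u))
    (λ u≤x → trans (·-congʳ n (y≤x⇒x∧y≈y u≤x))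
      (≤-antisym (·-mono n u≤x) (≤-respʳ (sym q) (x≤1 _))))

-- Homomorphisms and the derived operations.

module MVHomomorphismProperties {A : MVAlgebra a ℓ₁} {B : MVAlgebra b ℓ₂}
                                (f : MVHomomorphism A B) where
  private
    module A = MVOrder A
    module B = MVOrder B
  open MVHomomorphism f

  1-homo : ⟦ A.1# ⟧ B.≈ B.1#
  1-homo = B.trans (*-homo _) (B.*-cong 0-homo)

  ⊙-homo : ∀ x y → ⟦ x A.⊙ y ⟧ B.≈ ⟦ x ⟧ B.⊙ ⟦ y ⟧
  ⊙-homo x y = B.trans (*-homo _) (B.*-cong (B.trans (⊕-homo _ _) (B.⊕-cong (*-homo x) (*-homo y))))

  ∨-homo : ∀ x y → ⟦ x A.∨ y ⟧ B.≈ ⟦ x ⟧ B.∨ ⟦ y ⟧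
  ∨-homo x y = B.trans (⊕-homo _ _)
    (B.⊕-congʳ (B.trans (⊙-homo _ _) (B.⊙-cong B.refl (*-homo y))))

  ∧-homo : ∀ x y → ⟦ x A.∧ y ⟧ B.≈ ⟦ x ⟧ B.∧ ⟦ y ⟧
  ∧-homo x y = B.trans (⊙-homo _ _)
    (B.⊙-cong (B.trans (⊕-homo _ _) (B.⊕-congˡ (*-homo y))) B.refl)

  ·-homo : ∀ n x → ⟦ n A.· x ⟧ B.≈ n B.· ⟦ x ⟧
  ·-homo zero    x = 0-homo
  ·-homo (suc n) x = B.trans (⊕-homo _ _) (B.⊕-congˡ (·-homo n x))

  ≤-homo : ∀ {x y} → x A.≤ y → ⟦ x ⟧ B.≤ ⟦ y ⟧
  ≤-homo q = B.trans (B.⊕-congʳ (B.sym (*-homo _)))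
    (B.trans (B.sym (⊕-homo _ _)) (B.trans (cong q) 1-homo))

  ⊥-homo : ∀ {x y} → x A.⊥ y → ⟦ x ⟧ B.⊥ ⟦ y ⟧
  ⊥-homo q = B.trans (B.sym (⊙-homo _ _)) (B.trans (cong q) 0-homo)

  summable-homo : ∀ n {x} → A.Summable n x → B.Summable n ⟦ x ⟧
  summable-homo n s = B.⊥-resp-≈ B.refl (·-homo (pred n) _) (⊥-homo s)

  d-homo : ∀ x y → ⟦ A.d x y ⟧ B.≈ B.d ⟦ x ⟧ ⟦ y ⟧
  d-homo x y = B.trans (⊕-homo _ _) (B.⊕-cong (⊖-homo x y) (⊖-homo y x))
    where
    ⊖-homo : ∀ x y → ⟦ x A.⊙ y A.* ⟧ B.≈ ⟦ x ⟧ B.⊙ ⟦ y ⟧ B.*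
    ⊖-homo x y = B.trans (⊙-homo _ _) (B.⊙-cong B.refl (*-homo y))

-- Ideals and quotients by maximal ideals.

module _ {A : MVAlgebra a ℓ} where
  open MVOrder A

  projection : (I : Ideal A p) → MVHomomorphism A (Quotient.quotient A I)
  projection I = record
    { ⟦_⟧    = id
    ; cong   = ≈⇒∼
    ; ⊕-homo = λ _ _ → ≈⇒∼ refl
    ; *-homo = λ _ → ≈⇒∼ refl
    ; 0-homo = ≈⇒∼ refl
    }
    where open Quotient A I

  doubleNegation : Ideal A p → Ideal A p
  doubleNegation I = record
    { Member   = λ x → ¬ ¬ (x ∈ Member I)
    ; resp-≈   = λ q m k → m λ x∈I → k (I.resp-≈ q x∈I)
    ; 0-closed = λ k → k I.0-closed
    ; ≤-closed = λ q m k → m λ x∈I → k (I.≤-closed q x∈I)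
    ; ⊕-closed = λ m n k → m λ x∈I → n λ y∈I → k (I.⊕-closed x∈I y∈I)
    }
    where module I = Ideal I

  -- The ideal quotient I : b.
  residualIdeal : Ideal A p → Carrier → Ideal A p
  residualIdeal I b = record
    { Member   = λ x → x ∧ b ∈ Member I
    ; resp-≈   = λ q → I.resp-≈ (∧-cong q refl)
    ; 0-closed = I.≤-closed (x∧y≤x 0# b) I.0-closed
    ; ≤-closed = λ q → I.≤-closed (∧-glb (≤-trans (x∧y≤x _ _) q) (x∧y≤y _ _))
    ; ⊕-closed = λ x∈ y∈ → I.≤-closed (∧-sub-⊕ _ _ b) (I.⊕-closed x∈ y∈)
    }
    where module I = Ideal I

  -- The ideal generated by I and b, with x ≤ i ⊕ n · b for some i ∈ I expressed
  -- through I alone, so that membership stays in Set p.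
  adjoin : Ideal A p → Carrier → Ideal A p
  adjoin I b = record
    { Member   = λ x → Σ[ n ∈ ℕ ] x ⊙ (n · b) * ∈ Member I
    ; resp-≈   = λ q (n , m) → n , I.resp-≈ (⊙-cong q refl) m
    ; 0-closed = 0 , I.≤-closed (x⊖y≤x 0# _) I.0-closed
    ; ≤-closed = λ q (n , m) → n , I.≤-closed (residual (≤-trans q (x≤y⊕[x⊖y] _ _))) m
    ; ⊕-closed = λ { {x} {y} (m , x∈) (n , y∈) → m ℕ.+ n ,
        I.≤-closed (≤-respˡ (⊙-cong refl (*-cong (sym (·-homo-+ b m n)))) (⊖-⊕ x y _ _))
          (I.⊕-closed x∈ y∈) }
    }
    where module I = Ideal I

  module MaximalProperties (I : Ideal A p) (I-max : Maximal I) where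
    open Maximal I-max
    open Quotient A I using (_∼_; quotient)
    private module I = Ideal I

    stable-∈ : ∀ {x} → ¬ ¬ (x ∈ Member I) → x ∈ Member I
    stable-∈ = maximal (doubleNegation I) (λ k → k proper) (λ x∈I k → k x∈I)

    prime : ∀ {x y} → x ∧ y ∈ Member I → ¬ (y ∈ Member I) → x ∈ Member I
    prime {x} {y} x∧y∈I y∉I = maximal (residualIdeal I y)
      (λ 1∧y∈I → y∉I (I.≤-closed (∧-glb (x≤1 y) ≤-refl) 1∧y∈I))
      (I.≤-closed (x∧y≤x _ _)) x∧y∈I

    -- The quotient by I is simple.
    archimedean : ∀ {x} → ¬ (Σ[ n ∈ ℕ ] (n · x) * ∈ Member I) → x ∈ Member I
    archimedean {x} no-multiple = maximal (adjoin I x)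
      -- If `1#` were in the enlarged ideal, `1# ⊙ (n · x) *`, which is `(n · x) *`, would lie in
      -- `I`.
      (λ (n , m) → no-multiple (n , I.≤-closed
        (≤-reflexive (*-cong (sym (trans (⊕-cong (*-involutive 0#) (*-involutive _))
          (⊕-identityˡ _))))) m))
      (λ x∈I → 0 , I.≤-closed (x⊖y≤x _ _) x∈I)
      (1 , I.≤-closed (residual (≤-respʳ (sym (trans (⊕-identityʳ _) (⊕-identityʳ x))) ≤-refl))
        I.0-closed)

    isStableChain : IsStableChain quotient
    isStableChain = record
      -- The differences `y ⊙ x *` and `x ⊙ y *` meet in `0#`; the second is outside `I`, so
      -- primality puts the first inside.
      { total  = λ x≰y → stable-∈ λ ¬y≤x → ¬y≤x (≤-mod (prime
          (I.resp-≈ (sym (prelinear _ _)) I.0-closed) λ x⊖y∈I → x≰y (≤-mod x⊖y∈I)))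
      ; stable = stable-∈
      }
      where
      ≤-mod : ∀ {x y} → x ⊙ y * ∈ Member I → (x * ⊕ y) ∼ 1#
      -- Of the two halves of `d (x * ⊕ y) 1#`, the first is `0#` and the second lies below
      -- `x ⊙ y *`.
      ≤-mod {x} {y} x⊖y∈I = I.⊕-closed
        (I.resp-≈ (sym (trans (⊙-cong refl (*-involutive 0#)) (trans (⊙-comm _ _)
          (≤-antisym (x≤0 _) (0≤x _))))) I.0-closed)
        (I.≤-closed (≤-trans (≤-respˡ (⊙-comm _ _) (x⊖y≤x _ _))
          (≤-reflexive (*-cong (⊕-congˡ (sym (*-involutive y)))))) x⊖y∈I)
        where
        x≤0 : ∀ x → 0# ⊙ x ≤ 0#
        x≤0 x = ≤-respˡ (⊙-cong refl (*-involutive x)) (x⊖y≤x 0# (x *))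

-- Transfer of equations from maximal quotients to semisimple algebras.

module SemisimpleProperties {p} (A : MVAlgebra a ℓ) (semisimple : Semisimple p A) where
  open MVOrder A

  -- The hypothesis says that the distance `d x y` is in the radical.
  reflect : ∀ {x y} → ((I : Ideal A p) → Maximal I → Quotient._∼_ A I x y) → x ≈ y
  reflect q = d≈0⇒x≈y (semisimple _ q)

  private
    module Reduction (I : Ideal A p) (I-max : Maximal I) where
      open Quotient A I using (≈⇒∼; quotient) public
      module Q = MVOrder quotient
      module C = StableChainProperties quotient (MaximalProperties.isStableChain I I-max)
      open MVHomomorphismProperties (projection I) public using (·-homo; summable-homo)

  part-unique : ∀ n .{{_ : NonZero n}} {x y} → Summable n x → Summable n y →
                n · x ≈ n · y → x ≈ y
  part-unique n {x} {y} s t q = reflect λ I I-max → let open Reduction I I-max in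
    C.part-unique n (summable-homo n s) (summable-homo n t)
      (Q.trans (Q.sym (·-homo n x)) (Q.trans (≈⇒∼ q) (·-homo n y)))

  part-∨ : ∀ n .{{_ : NonZero n}} k {w x y} → Summable n w → Summable n x → Summable n y →
           n · w ≈ n · x ∨ n · y → k · w ≈ k · x ∨ k · y
  part-∨ n k {w} {x} {y} r s t q = reflect λ I I-max → let open Reduction I I-max in
    Q.trans (·-homo k w) (Q.trans
      (C.part-∨ n k (summable-homo n r) (summable-homo n s) (summable-homo n t)
        (Q.trans (Q.sym (·-homo n w)) (Q.trans (≈⇒∼ q) (Q.∨-cong (·-homo n x) (·-homo n y)))))
      (Q.sym (Q.∨-cong (·-homo k x) (·-homo k y))))

  part-∧ : ∀ n .{{_ : NonZero n}} k {w x y} → Summable n w → Summable n x → Summable n y →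
           n · w ≈ n · x ∧ n · y → k · w ≈ k · x ∧ k · y
  part-∧ n k {w} {x} {y} r s t q = reflect λ I I-max → let open Reduction I I-max in
    Q.trans (·-homo k w) (Q.trans
      (C.part-∧ n k (summable-homo n r) (summable-homo n s) (summable-homo n t)
        (Q.trans (Q.sym (·-homo n w)) (Q.trans (≈⇒∼ q) (Q.∧-cong (·-homo n x) (·-homo n y)))))
      (Q.sym (Q.∧-cong (·-homo k x) (·-homo k y))))

  ·-∧-unit : ∀ n x {u} → n · u ≈ 1# → n · (x ∧ u) ≈ n · x
  ·-∧-unit n x {u} q = reflect λ I I-max → let open Reduction I I-max in
    Q.trans (·-homo n _) (Q.trans
      (C.·-∧-unit n x (Q.trans (Q.sym (·-homo n u)) (≈⇒∼ q)))
      (Q.sym (·-homo n x)))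

-- Preimages of maximal ideals.

module _ {A : MVAlgebra a ℓ₁} {B : MVAlgebra b ℓ₂} (f : MVHomomorphism A B) where
  private
    module A = MVOrder A
    module B = MVOrder B
  open MVHomomorphism f
  open MVHomomorphismProperties f

  preimage : Ideal B p → Ideal A p
  preimage I = record
    { Member   = λ x → ⟦ x ⟧ ∈ Member I
    ; resp-≈   = λ q → I.resp-≈ (cong q)
    ; 0-closed = I.resp-≈ (B.sym 0-homo) I.0-closed
    ; ≤-closed = λ q → I.≤-closed (≤-homo q)
    ; ⊕-closed = λ x∈ y∈ → I.resp-≈ (B.sym (⊕-homo _ _)) (I.⊕-closed x∈ y∈)
    }
    where module I = Ideal I

  -- Were x ∈ J outside the preimage, some n · ⟦ x ⟧ would be 1 modulo I, so (n · x) *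
  -- would lie in the preimage and hence in J, together with n · x.
  preimage-maximal : (I : Ideal B p) → Maximal I → Maximal (preimage I)
  preimage-maximal I I-max = record
    { proper  = λ 1∈ → Maximal.proper I-max (Ideal.resp-≈ I 1-homo 1∈)
    ; maximal = λ J J-proper ⊆J {x} x∈J → stable-∈ λ x∉ → x∉ (archimedean λ (n , m) →
        J-proper (Ideal.resp-≈ J (A.*-inverseˡ (n A.· x)) (Ideal.⊕-closed J
          (⊆J (Ideal.resp-≈ I (B.sym (B.trans (*-homo _) (B.*-cong (·-homo n x)))) m))
          (multiple∈ J n x∈J))))
    }
    where
    open MaximalProperties I I-max
    multiple∈ : (J : Ideal A _) → ∀ n {x} → x ∈ Member J → n A.· x ∈ Member J
    multiple∈ J zero    _   = Ideal.0-closed J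
    multiple∈ J (suc n) x∈J = Ideal.⊕-closed J x∈J (multiple∈ J n x∈J)

  /Rad-cong : Semisimple p B → ∀ {x y} → MVAlgebra._≈_ (A /Rad[ p ]) x y → ⟦ x ⟧ B.≈ ⟦ y ⟧
  /Rad-cong semisimple {x} {y} q = SemisimpleProperties.reflect B semisimple λ I I-max →
    Ideal.resp-≈ I (d-homo x y) (q (preimage I) (preimage-maximal I I-max))

-- Maps preserving partial sums.

-- This is what a bimorphism gives in one argument when the other is fixed; such a map need not send
-- `1#` to `1#`.
record IsAdditive (A : MVAlgebra a ℓ₁) (B : MVAlgebra b ℓ₂)
                  (g : MVAlgebra.Carrier A → MVAlgebra.Carrier B) : Set (a ⊔ ℓ₁ ⊔ ℓ₂) where
  private
    module A = MVOrder A
    module B = MVOrder B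
  field
    cong   : ∀ {x y} → x A.≈ y → g x B.≈ g y
    ⊥-homo : ∀ {x y} → x A.⊥ y → g x B.⊥ g y
    +-homo : ∀ {x y} → x A.⊥ y → g (x A.⊕ y) B.≈ g x B.⊕ g y

  -- Additivity makes `g A.0#` equal to its own defined double, and one copy cancels.
  0-homo : g A.0# B.≈ B.0#
  0-homo = B.≤-antisym (B.⊕-cancelʳ-≤ (⊥-homo (A.0⊥x A.0#))
    (B.≤-reflexive (B.trans (B.sym (+-homo (A.0⊥x A.0#)))
      (B.trans (cong (A.⊕-identityˡ _)) (B.sym (B.⊕-identityˡ _)))))) (B.0≤x _)

  mono : ∀ {x y} → x A.≤ y → g x B.≤ g y
  mono {x} {y} x≤y = B.≤-respʳ
    (B.trans (B.sym (+-homo x⊥y⊖x)) (cong (A.sym (A.difference x≤y)))) (B.x≤x⊕y _ _)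
    where
    x⊥y⊖x : x A.⊥ (y A.* A.⊕ x) A.*
    x⊥y⊖x = A.≤*⇒⊥ (A.≤-respʳ (A.sym (A.*-involutive _)) (A.x≤y⊕x x _))

  ·-homo : ∀ {n} k {x} → A.Summable n x → k ℕ.≤ n → g (k A.· x) B.≈ k B.· g x
  ·-homo zero    _ _ = 0-homo
  ·-homo {suc n} (suc k) {x} s (s≤s k≤n) =
    B.trans (+-homo (A.⊥-mono A.≤-refl (A.·-monoˡ x k≤n) s))
      (B.⊕-congˡ (·-homo k s (ℕₚ.m≤n⇒m≤1+n k≤n)))

  summable-homo : ∀ n {x} → A.Summable n x → B.Summable n (g x)
  summable-homo n s = B.⊥-resp-≈ B.refl (·-homo {n} (pred n) s ℕₚ.pred[n]≤n) (⊥-homo s)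

  module _ (comparable : ∀ x y → x A.≤ y ⊎ y A.≤ x) where

    -- On a linearly ordered domain monotonicity suffices, because the join is the larger argument.
    ∨-homo : ∀ x y → g (x A.∨ y) B.≈ g x B.∨ g y
    ∨-homo x y with comparable x y
    ... | inj₁ x≤y = B.trans (cong (A.x≤y⇒x∨y≈y x≤y)) (B.sym (B.x≤y⇒x∨y≈y (mono x≤y)))
    ... | inj₂ y≤x = B.trans (cong (A.y≤x⇒x∨y≈x y≤x)) (B.sym (B.y≤x⇒x∨y≈x (mono y≤x)))

    ∧-homo : ∀ x y → g (x A.∧ y) B.≈ g x B.∧ g y
    ∧-homo x y with comparable x y
    ... | inj₁ x≤y = B.trans (cong (A.x≤y⇒x∧y≈x x≤y)) (B.sym (B.x≤y⇒x∧y≈x (mono x≤y)))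
    ... | inj₂ y≤x = B.trans (cong (A.y≤x⇒x∧y≈y y≤x)) (B.sym (B.y≤x⇒x∧y≈y (mono y≤x)))

-- Fractions in the rational unit interval.

module 𝕀 = MVOrder [0,1]ℚ

/-≡ : ∀ j k m n .{{_ : NonZero m}} .{{_ : NonZero n}} →
      j ℕ.* n ≡ k ℕ.* m → + j ℚ./ m ≡ + k ℚ./ n
/-≡ j k (suc m) (suc n) q = ℚₚ.fromℚᵘ-cong {mkℚᵘ (+ j) m} {mkℚᵘ (+ k) n}
  (*≡* (≡.trans (≡.sym (ℤₚ.pos-* j (suc n))) (≡.trans (≡.cong +_ q) (ℤₚ.pos-* k (suc m)))))

/-injective : ∀ j k m n .{{_ : NonZero m}} .{{_ : NonZero n}} →
              + j ℚ./ m ≡ + k ℚ./ n → j ℕ.* n ≡ k ℕ.* m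
/-injective j k (suc m) (suc n) q
  with *≡* r ← ℚₚ.fromℚᵘ-injective {mkℚᵘ (+ j) m} {mkℚᵘ (+ k) n} q =
  ℤₚ.+-injective (≡.trans (ℤₚ.pos-* j (suc n)) (≡.trans r (≡.sym (ℤₚ.pos-* k (suc m)))))

toℚᵘ-/ : ∀ k n → ℚ.toℚᵘ (+ k ℚ./ suc n) ℚᵘ.≃ mkℚᵘ (+ k) n
toℚᵘ-/ k n = ℚₚ.toℚᵘ-fromℚᵘ (mkℚᵘ (+ k) n)

/-≤1 : ∀ {k n} .{{_ : NonZero n}} → k ℕ.≤ n → + k ℚ./ n ℚ.≤ 1ℚ
/-≤1 {k} {suc n} k≤n = ℚₚ.toℚᵘ-cancel-≤ (ℚᵘₚ.≤-respˡ-≃ (ℚᵘₚ.≃-sym (toℚᵘ-/ k n))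
  (*≤* (≡.subst₂ ℤ._≤_ (≡.sym (ℤₚ.*-identityʳ (+ k))) (≡.sym (ℤₚ.*-identityˡ (+ suc n)))
    (ℤ.+≤+ k≤n))))

/-≤1⁻¹ : ∀ {k n} .{{_ : NonZero n}} → + k ℚ./ n ℚ.≤ 1ℚ → k ℕ.≤ n
/-≤1⁻¹ {k} {suc n} q with *≤* r ← ℚᵘₚ.≤-respˡ-≃ (toℚᵘ-/ k n) (ℚₚ.toℚᵘ-mono-≤ q) =
  ℤₚ.drop‿+≤+ (≡.subst₂ ℤ._≤_ (ℤₚ.*-identityʳ (+ k)) (ℤₚ.*-identityˡ (+ suc n)) r)

/-+ : ∀ j k n .{{_ : NonZero n}} → (+ j ℚ./ n) ℚ.+ (+ k ℚ./ n) ≡ + (j ℕ.+ k) ℚ./ n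
/-+ j k (suc n) = ℚₚ.toℚᵘ-injective (begin
  ℚ.toℚᵘ ((+ j ℚ./ suc n) ℚ.+ (+ k ℚ./ suc n))
    ≈⟨ ℚₚ.toℚᵘ-homo-+ (+ j ℚ./ suc n) (+ k ℚ./ suc n) ⟩
  ℚ.toℚᵘ (+ j ℚ./ suc n) ℚᵘ.+ ℚ.toℚᵘ (+ k ℚ./ suc n)
    ≈⟨ ℚᵘₚ.+-cong (toℚᵘ-/ j n) (toℚᵘ-/ k n) ⟩
  mkℚᵘ (+ j) n ℚᵘ.+ mkℚᵘ (+ k) n
    ≈⟨ *≡* (≡.trans (≡.cong (ℤ._* + suc n) (≡.sym (ℤₚ.*-distribʳ-+ (+ suc n) (+ j) (+ k))))
                (ℤₚ.*-assoc (+ j ℤ.+ + k) (+ suc n) (+ suc n))) ⟩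
  mkℚᵘ (+ (j ℕ.+ k)) n
    ≈⟨ toℚᵘ-/ (j ℕ.+ k) n ⟨
  ℚ.toℚᵘ (+ (j ℕ.+ k) ℚ./ suc n) ∎)
  where
  open ℚᵘₚ.≃-Reasoning

0≤/ : ∀ k n .{{_ : NonZero n}} → 0ℚ ℚ.≤ + k ℚ./ n
0≤/ k n = ℚₚ.nonNegative⁻¹ (+ k ℚ./ n) {{ℚₚ.normalize-nonNeg k n}}

infix 4 _IsFraction_/_

-- A record because k and n cannot be inferred from the normalised quotient k / n.
record _IsFraction_/_ (x : 𝕀.Carrier) (k n : ℕ) .{{_ : NonZero n}} : Set where
  constructor isFraction
  field value : proj₁ x ≡ + k ℚ./ n

open _IsFraction_/_

fraction : ∀ k n .{{_ : NonZero n}} → k ℕ.≤ n → 𝕀.Carrier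
fraction k n k≤n = + k ℚ./ n , 0≤/ k n , /-≤1 k≤n

numerator : 𝕀.Carrier → ℕ
numerator (q , _) = ∣ ↥ q ∣

denominator : 𝕀.Carrier → ℕ
denominator (q , _) = ↧ₙ q

as-fraction : ∀ x → x IsFraction numerator x / denominator x
as-fraction (q@(ℚ.mkℚ (+ _) _ _)    , _         , _) = isFraction (≡.sym (ℚₚ.↥p/↧p≡p q))
-- A negative numerator contradicts the lower bound 0.
as-fraction (ℚ.mkℚ (ℤ.-[1+ _ ]) _ _ , ℚ.*≤* () , _)

fraction-≈ : ∀ {x y j k m n} .{{_ : NonZero m}} .{{_ : NonZero n}} →
             x IsFraction j / m → y IsFraction k / n → j ℕ.* n ≡ k ℕ.* m → x 𝕀.≈ y
fraction-≈ {j = j} {k} {m} {n} (isFraction q) (isFraction r) e =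
  ≡.trans q (≡.trans (/-≡ j k m n e) (≡.sym r))

fraction-resp-≈ : ∀ {x y k n} .{{_ : NonZero n}} → x 𝕀.≈ y → x IsFraction k / n → y IsFraction k / n
fraction-resp-≈ q (isFraction r) = isFraction (≡.trans (≡.sym q) r)

rescale : ∀ {x j k m n} .{{_ : NonZero m}} .{{_ : NonZero n}} →
          x IsFraction j / m → j ℕ.* n ≡ k ℕ.* m → x IsFraction k / n
rescale {j = j} {k} {m} {n} (isFraction q) e = isFraction (≡.trans q (/-≡ j k m n e))

-- An inequality depends only on the difference of its sides, so translating between inequalities
-- reduces to an identity for the ring solver.
≤-cross : ∀ w x y z → w ℚ.- x ≡ y ℚ.- z → x ℚ.≤ w → z ℚ.≤ y
≤-cross w x y z q x≤w = ≡.subst₂ ℚ._≤_ (ℚₚ.+-identityˡ z) (cancel y z)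
  (ℚₚ.+-monoˡ-≤ z (≡.subst₂ ℚ._≤_ (ℚₚ.+-inverseʳ x) q (ℚₚ.+-monoˡ-≤ (ℚ.- x) x≤w)))
  where
  open ℚ-Solver.+-*-Solver
  cancel : ∀ y z → (y ℚ.- z) ℚ.+ z ≡ y
  cancel = solve 2 (λ y z → (y :- z) :+ z := y) ≡.refl

≤ℚ⇒≤ : ∀ x y → proj₁ x ℚ.≤ proj₁ y → x 𝕀.≤ y
≤ℚ⇒≤ (x , _) (y , _) x≤y = ℚₚ.p≥q⇒p⊓q≡q (≤-cross y x (1ℚ ℚ.- x ℚ.+ y) 1ℚ
  (solve 2 (λ x y → y :- x := (con 1ℚ :- x :+ y) :- con 1ℚ) ≡.refl x y) x≤y)
  where open ℚ-Solver.+-*-Solver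

≤⇒≤ℚ : ∀ x y → x 𝕀.≤ y → proj₁ x ℚ.≤ proj₁ y
≤⇒≤ℚ (x , _) (y , _) q = ≤-cross (1ℚ ℚ.- x ℚ.+ y) 1ℚ y x
  (solve 2 (λ x y → (con 1ℚ :- x :+ y) :- con 1ℚ := y :- x) ≡.refl x y)
  (≡.subst (ℚ._≤ (1ℚ ℚ.- x ℚ.+ y)) q (ℚₚ.p⊓q≤p (1ℚ ℚ.- x ℚ.+ y) 1ℚ))
  where open ℚ-Solver.+-*-Solver

comparable : ∀ x y → x 𝕀.≤ y ⊎ y 𝕀.≤ x
comparable x y = Sum.map (≤ℚ⇒≤ x y) (≤ℚ⇒≤ y x) (ℚₚ.≤-total (proj₁ x) (proj₁ y))

+≤1⇒⊥ : ∀ x y → proj₁ x ℚ.+ proj₁ y ℚ.≤ 1ℚ → x 𝕀.⊥ y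
+≤1⇒⊥ x y q = 𝕀.≤*⇒⊥ {x} {y} (≤ℚ⇒≤ x (y 𝕀.*) (≤-cross 1ℚ _ _ _
  (solve 2 (λ x y → con 1ℚ :- (x :+ y) := (con 1ℚ :- y) :- x) ≡.refl (proj₁ x) (proj₁ y)) q))
  where open ℚ-Solver.+-*-Solver

⊥⇒+≤1 : ∀ x y → x 𝕀.⊥ y → proj₁ x ℚ.+ proj₁ y ℚ.≤ 1ℚ
⊥⇒+≤1 x y q = ≤-cross _ _ 1ℚ _
  (solve 2 (λ x y → (con 1ℚ :- y) :- x := con 1ℚ :- (x :+ y)) ≡.refl (proj₁ x) (proj₁ y))
  (≤⇒≤ℚ x (y 𝕀.*) (𝕀.⊥⇒≤* {x} {y} q))
  where open ℚ-Solver.+-*-Solver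

numerator≤denominator : ∀ x → numerator x ℕ.≤ denominator x
numerator≤denominator x@(_ , _ , x≤1) = /-≤1⁻¹ (≡.subst (ℚ._≤ 1ℚ) (value (as-fraction x)) x≤1)

module _ {n} .{{_ : NonZero n}} where

  fraction-sum : ∀ {x y j k} → x IsFraction j / n → y IsFraction k / n →
                 proj₁ x ℚ.+ proj₁ y ≡ + (j ℕ.+ k) ℚ./ n
  fraction-sum {j = j} {k} (isFraction q) (isFraction r) =
    ≡.trans (≡.cong₂ ℚ._+_ q r) (/-+ j k n)

  fraction-⊥ : ∀ {x y j k} → x IsFraction j / n → y IsFraction k / n → j ℕ.+ k ℕ.≤ n → x 𝕀.⊥ y
  fraction-⊥ {x} {y} q r j+k≤n =
    +≤1⇒⊥ x y (≡.subst (ℚ._≤ 1ℚ) (≡.sym (fraction-sum q r)) (/-≤1 j+k≤n))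

  fraction-⊥⁻¹ : ∀ {x y j k} → x IsFraction j / n → y IsFraction k / n → x 𝕀.⊥ y → j ℕ.+ k ℕ.≤ n
  fraction-⊥⁻¹ {x} {y} q r x⊥y =
    /-≤1⁻¹ (≡.subst (ℚ._≤ 1ℚ) (fraction-sum q r) (⊥⇒+≤1 x y x⊥y))

  fraction-⊕ : ∀ {x y j k} → x IsFraction j / n → y IsFraction k / n → j ℕ.+ k ℕ.≤ n →
               x 𝕀.⊕ y IsFraction (j ℕ.+ k) / n
  fraction-⊕ q r j+k≤n = isFraction
    (≡.trans (≡.cong (ℚ._⊓ 1ℚ) (fraction-sum q r)) (ℚₚ.p≤q⇒p⊓q≡p (/-≤1 j+k≤n)))

  fraction-· : ∀ m {x k} → x IsFraction k / n → m ℕ.* k ℕ.≤ n → m 𝕀.· x IsFraction (m ℕ.* k) / n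
  fraction-· zero    q _ = isFraction (/-≡ 0 0 1 n ≡.refl)
  fraction-· (suc m) {x} {k} q r =
    fraction-⊕ q (fraction-· m q (ℕₚ.≤-trans (ℕₚ.m≤n+m (m ℕ.* k) k) r)) r

  fraction-summable : ∀ m {x k} → x IsFraction k / n → m ℕ.* k ℕ.≤ n → 𝕀.Summable m x
  fraction-summable zero    {x} q r = 𝕀.⊥-sym {𝕀.0#} {x} (𝕀.0⊥x x)
  fraction-summable (suc m) {x} {k} q r =
    fraction-⊥ q (fraction-· m q (ℕₚ.≤-trans (ℕₚ.m≤n+m (m ℕ.* k) k) r)) r

-- Rational scalars acting on a semisimple DMV-algebra.

module Scalar {p} (A : MVAlgebra a ℓ) (semisimple : Semisimple p A)
              (divisionOperators : DivisionOperators A) where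
  open MVOrder A
  open SemisimpleProperties A semisimple
  open DivisionOperators divisionOperators

  -- Both sides are n-th parts of `x`. Keeping `N` separate from the product lets one common
  -- denominator be factored in either order.
  δ-refine : ∀ n k {N} .{{_ : NonZero n}} .{{_ : NonZero N}} → N ≡ n ℕ.* k → ∀ x →
             k · δ N x ≈ δ n x
  δ-refine n k {N} ≡.refl x = part-unique n (summable-· n k (δ-⊥ N x)) (δ-⊥ n x)
    (trans (·-assocˡ _ n k) (trans (·-δ N x) (sym (·-δ n x))))

  δ-⊥-homo : ∀ n .{{_ : NonZero n}} {x y} → x ⊥ y → (n · δ n x) ⊥ (n · δ n y)
  δ-⊥-homo n = ⊥-resp-≈ (sym (·-δ n _)) (sym (·-δ n _))

  -- Both sides are n-th parts of `x ⊕ y`; orthogonality of `x` and `y` makes the right one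
  -- summable.
  δ-+-homo : ∀ n .{{_ : NonZero n}} {x y} → x ⊥ y → δ n (x ⊕ y) ≈ δ n x ⊕ δ n y
  δ-+-homo n {x} {y} x⊥y = part-unique n (δ-⊥ n _)
    (summable-⊕ n (δ-⊥ n x) (δ-⊥ n y) (δ-⊥-homo n x⊥y))
    (trans (·-δ n _) (sym (trans (·-distrib-⊕ _ _ n) (⊕-cong (·-δ n x) (·-δ n y)))))

  infixr 8 _•_

  _•_ : 𝕀.Carrier → Carrier → Carrier
  q • x = numerator q · δ (denominator q) x

  -- Independence of the representing fraction: both sides are counted in copies of `δ (m * n) x`,
  -- where cross-multiplication equates the counts.
  •-fraction : ∀ {q k n} .{{_ : NonZero n}} → q IsFraction k / n → ∀ x → q • x ≈ k · δ n x
  •-fraction {q} {k} {n} q≡k/n x = begin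
    j · δ m x                ≈⟨ ·-congʳ j (δ-refine m n ≡.refl x) ⟨
    j · n · δ (m ℕ.* n) x    ≈⟨ ·-assocˡ _ j n ⟩
    (j ℕ.* n) · δ (m ℕ.* n) x  ≈⟨ ·-congˡ j*n≡k*m ⟩
    (k ℕ.* m) · δ (m ℕ.* n) x  ≈⟨ ·-assocˡ _ k m ⟨
    k · m · δ (m ℕ.* n) x    ≈⟨ ·-congʳ k (δ-refine n m (ℕₚ.*-comm m n) x) ⟩
    k · δ n x                ∎
    where
    open SetoidReasoning setoid
    j m : ℕ
    j = numerator q
    m = denominator q
    j*n≡k*m : j ℕ.* n ≡ k ℕ.* m
    j*n≡k*m = /-injective j k m n (≡.trans (≡.sym (value (as-fraction q))) (value q≡k/n))
    instance
      m*n≢0 : NonZero (m ℕ.* n)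
      m*n≢0 = ℕₚ.m*n≢0 m n

  •-cong : ∀ {q r x y} → q 𝕀.≈ r → x ≈ y → q • x ≈ r • y
  •-cong {q} {r} {x} {y} q≈r x≈y =
    trans (•-fraction {q} (fraction-resp-≈ {r} (≡.sym q≈r) (as-fraction r)) x)
          (·-congʳ (numerator r) (δ-cong (denominator r) x≈y))

  1• : ∀ x → 𝕀.1# • x ≈ x
  1• x = ·-δ 1 x

  -- Over a common denominator `n`, orthogonality and addition of scalars become counting of copies
  -- of `δ n x`.
  •-isAdditiveˡ : ∀ x → IsAdditive [0,1]ℚ A (_• x)
  •-isAdditiveˡ x = record
    { cong   = λ {q} {r} q≈r → •-cong {q} {r} q≈r refl
    ; ⊥-homo = λ {q} {r} q⊥r → let open Common q r in
        ⊥-resp-≈ (sym (•-fraction q≡ x)) (sym (•-fraction r≡ x))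
          (summable⇒⊥ j k (δ-⊥ n x) (fraction-⊥⁻¹ q≡ r≡ q⊥r))
    ; +-homo = λ {q} {r} q⊥r → let open Common q r in
        trans (•-fraction (fraction-⊕ q≡ r≡ (fraction-⊥⁻¹ q≡ r≡ q⊥r)) x)
          (trans (·-homo-+ _ j k)
            (⊕-cong (sym (•-fraction q≡ x)) (sym (•-fraction r≡ x))))
    }
    where
    module Common (q r : 𝕀.Carrier) where
      n j k : ℕ
      n = denominator q ℕ.* denominator r
      j = numerator q ℕ.* denominator r
      k = numerator r ℕ.* denominator q
      open +-*-Solver
      q≡ : q IsFraction j / n
      q≡ = rescale (as-fraction q) (solve 3
        (λ a b c → a :* (b :* c) := a :* c :* b) ≡.refl
        (numerator q) (denominator q) (denominator r))
      r≡ : r IsFraction k / n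
      r≡ = rescale (as-fraction r) (solve 3
        (λ a b c → a :* (b :* c) := a :* b :* c) ≡.refl
        (numerator r) (denominator q) (denominator r))

  •-isAdditiveʳ : ∀ q → IsAdditive A A (q •_)
  •-isAdditiveʳ q = record
    { cong   = •-cong {q} {q} ≡.refl
    -- As the numerator is at most the denominator, `q • x` lies below `n · δ n x`, that is, below
    -- `x`.
    ; ⊥-homo = λ x⊥y → ⊥-mono (·-monoˡ _ j≤n) (·-monoˡ _ j≤n) (δ-⊥-homo n x⊥y)
    ; +-homo = λ x⊥y → trans (·-congʳ j (δ-+-homo n x⊥y)) (·-distrib-⊕ _ _ j)
    }
    where
    n j : ℕ
    n = denominator q
    j = numerator q
    j≤n : j ℕ.≤ n
    j≤n = numerator≤denominator q

  •-bimorphism : Bimorphism [0,1]ℚ A A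
  •-bimorphism = record
    { β      = _•_
    ; β-cong = λ {q} {r} → •-cong {q} {r}
    ; β-1    = 1• 1#
    ; β-∨ˡ   = λ q r x → IsAdditive.∨-homo (•-isAdditiveˡ x) comparable q r
    -- `A` need not be a chain, so joins in this argument rest on the comparison of parts in maximal
    -- quotients.
    ; β-∨ʳ   = λ q x y → let n = denominator q in
        part-∨ n (numerator q) (δ-⊥ n _) (δ-⊥ n x) (δ-⊥ n y)
          (trans (·-δ n _) (sym (∨-cong (·-δ n x) (·-δ n y))))
    ; β-∧ˡ   = λ q r x → IsAdditive.∧-homo (•-isAdditiveˡ x) comparable q r
    ; β-∧ʳ   = λ q x y → let n = denominator q in
        part-∧ n (numerator q) (δ-⊥ n _) (δ-⊥ n x) (δ-⊥ n y)
          (trans (·-δ n _) (sym (∧-cong (·-δ n x) (·-δ n y))))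
    ; β-⊥ˡ   = λ {q} {r} x → IsAdditive.⊥-homo (•-isAdditiveˡ x) {q} {r}
    ; β-⊥ʳ   = λ q → IsAdditive.⊥-homo (•-isAdditiveʳ q)
    ; β-+ˡ   = λ {q} {r} x → IsAdditive.+-homo (•-isAdditiveˡ x) {q} {r}
    ; β-+ʳ   = λ q → IsAdditive.+-homo (•-isAdditiveʳ q)
    }

-- Bimorphisms and the homomorphism obtained at `1#`.

module BimorphismProperties {A : MVAlgebra a ℓ₁} {B : MVAlgebra b ℓ₂} {C : MVAlgebra c ℓ₃}
                            (F : Bimorphism A B C) where
  private
    module A = MVOrder A
    module B = MVOrder B
    module C = MVOrder C
  open Bimorphism F

  isAdditiveˡ : ∀ y → IsAdditive A C (λ x → β x y)
  isAdditiveˡ y = record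
    { cong = λ q → β-cong q B.refl ; ⊥-homo = β-⊥ˡ y ; +-homo = β-+ˡ y }

  isAdditiveʳ : ∀ x → IsAdditive B C (β x)
  isAdditiveʳ x = record
    { cong = β-cong A.refl ; ⊥-homo = β-⊥ʳ x ; +-homo = β-+ʳ x }

  β-mono : ∀ {x x′ y y′} → x A.≤ x′ → y B.≤ y′ → β x y C.≤ β x′ y′
  β-mono q r = C.≤-trans (IsAdditive.mono (isAdditiveˡ _) q) (IsAdditive.mono (isAdditiveʳ _) r)

  -- Since x ⊕ y = x + (x * ∧ y), preservation of partial sums and meets suffices.
  β-1-homomorphism : MVHomomorphism B C
  β-1-homomorphism = record
    { ⟦_⟧    = g
    ; cong   = β-cong A.refl
    ; ⊕-homo = λ x y → begin
        g (x B.⊕ y)                     ≈⟨ β-cong A.refl (B.⊕-as-+ x y) ⟨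
        g (x B.⊕ (x B.* B.∧ y))         ≈⟨ β-+ʳ A.1# (B.⊥-mono B.≤-refl (B.x∧y≤x _ y) (B.x⊥x* x)) ⟩
        g x C.⊕ g (x B.* B.∧ y)         ≈⟨ C.⊕-congˡ (β-∧ʳ A.1# _ y) ⟩
        g x C.⊕ (g (x B.*) C.∧ g y)     ≈⟨ C.⊕-congˡ (C.∧-cong (*-homo x) C.refl) ⟩
        g x C.⊕ (g x C.* C.∧ g y)       ≈⟨ C.⊕-as-+ (g x) (g y) ⟩
        g x C.⊕ g y                     ∎
    ; *-homo = *-homo
    ; 0-homo = IsAdditive.0-homo (isAdditiveʳ A.1#)
    }
    where
    open SetoidReasoning C.setoid
    g : B.Carrier → C.Carrier
    g = β A.1#
    *-homo : ∀ x → g (x B.*) C.≈ g x C.*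
    -- The images of `x` and `x *` are orthogonal, and their sum is the image of `1#`.
    *-homo x = C.complement (β-⊥ʳ A.1# (B.x⊥x* x))
      (C.trans (C.sym (β-+ʳ A.1# (B.x⊥x* x)))
        (C.trans (β-cong A.refl (B.trans (B.⊕-comm _ _) (B.*-inverseˡ x))) β-1))

_∘ʳ_ : {A : MVAlgebra a ℓ₁} {B : MVAlgebra b ℓ₂} {B′ : MVAlgebra b′ ℓ₂′} {C : MVAlgebra c ℓ₃} →
       Bimorphism A B C → MVHomomorphism B′ B → Bimorphism A B′ C
_∘ʳ_ {A = A} {B} {B′} {C} F f = record
  { β      = λ x y → β x ⟦ y ⟧
  ; β-cong = λ q r → β-cong q (cong r)
  ; β-1    = C.trans (β-cong A.refl 1-homo) β-1
  ; β-∨ˡ   = λ x x′ y → β-∨ˡ x x′ ⟦ y ⟧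
  ; β-∨ʳ   = λ x y y′ → C.trans (β-cong A.refl (∨-homo y y′)) (β-∨ʳ x ⟦ y ⟧ ⟦ y′ ⟧)
  ; β-∧ˡ   = λ x x′ y → β-∧ˡ x x′ ⟦ y ⟧
  ; β-∧ʳ   = λ x y y′ → C.trans (β-cong A.refl (∧-homo y y′)) (β-∧ʳ x ⟦ y ⟧ ⟦ y′ ⟧)
  ; β-⊥ˡ   = λ y → β-⊥ˡ ⟦ y ⟧
  ; β-⊥ʳ   = λ x q → β-⊥ʳ x (⊥-homo q)
  ; β-+ˡ   = λ y → β-+ˡ ⟦ y ⟧
  ; β-+ʳ   = λ x q → C.trans (β-cong A.refl (⊕-homo _ _)) (β-+ʳ x (⊥-homo q))
  }
  where
  module A = MVAlgebra A
  module C = MVAlgebra C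
  open Bimorphism F
  open MVHomomorphism f
  open MVHomomorphismProperties f using (1-homo; ∨-homo; ∧-homo; ⊥-homo)

-- Division by n in the rational unit interval.

unitFraction : ∀ n .{{_ : NonZero n}} → 𝕀.Carrier
unitFraction n = fraction 1 n (ℕ.>-nonZero⁻¹ n)

unitFraction-isFraction : ∀ n .{{_ : NonZero n}} → unitFraction n IsFraction 1 / n
unitFraction-isFraction n = isFraction ≡.refl

k·unitFraction : ∀ {k n} .{{_ : NonZero n}} → k ℕ.≤ n →
                 k 𝕀.· unitFraction n IsFraction k / n
k·unitFraction {k} {n} k≤n = rescale
  (fraction-· k (unitFraction-isFraction n) (≡.subst (ℕ._≤ n) (≡.sym (ℕₚ.*-identityʳ k)) k≤n))
  (≡.cong (ℕ._* n) (ℕₚ.*-identityʳ k))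

unitFraction-summable : ∀ n .{{_ : NonZero n}} → 𝕀.Summable n (unitFraction n)
unitFraction-summable n =
  fraction-summable n (unitFraction-isFraction n) (ℕₚ.≤-reflexive (ℕₚ.*-identityʳ n))

n·unitFraction≈1 : ∀ n .{{_ : NonZero n}} → n 𝕀.· unitFraction n 𝕀.≈ 𝕀.1#
n·unitFraction≈1 n = fraction-≈ {y = 𝕀.1#}
  (k·unitFraction {n} {n} ℕₚ.≤-refl) (as-fraction 𝕀.1#) (ℕₚ.*-comm n 1)

module _ (n : ℕ) .{{_ : NonZero n}} (q : 𝕀.Carrier) where
  private
    j m : ℕ
    j = numerator q
    m = denominator q
    j≤m : j ℕ.≤ m
    j≤m = numerator≤denominator q
    instance
      m*n≢0 : NonZero (m ℕ.* n)
      m*n≢0 = ℕₚ.m*n≢0 m n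

    n*j≤m*n : n ℕ.* j ℕ.≤ m ℕ.* n
    n*j≤m*n = ≡.subst (n ℕ.* j ℕ.≤_) (ℕₚ.*-comm n m) (ℕₚ.*-monoʳ-≤ n j≤m)

    m≤m*n : m ℕ.≤ m ℕ.* n
    m≤m*n = ℕₚ.m≤m*n m n

    quotient : ∀ {k} → k ℕ.≤ m → 𝕀.Carrier
    quotient {k} k≤m = fraction k (m ℕ.* n) (ℕₚ.≤-trans k≤m m≤m*n)

    isQuotient : ∀ {k} (k≤m : k ℕ.≤ m) → quotient k≤m IsFraction k / (m ℕ.* n)
    isQuotient _ = isFraction ≡.refl

  divide : 𝕀.Carrier
  divide = quotient j≤m

  divide-summable : 𝕀.Summable n divide
  divide-summable = fraction-summable n (isQuotient j≤m) n*j≤m*n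

  n·divide : n 𝕀.· divide 𝕀.≈ q
  n·divide = fraction-≈ {y = q} (fraction-· n (isQuotient j≤m) n*j≤m*n) (as-fraction q)
    (solve 3 (λ n j m → n :* j :* m := j :* (m :* n)) ≡.refl n j m)
    where open +-*-Solver

  -- The element `rest`, which is (m - j)/(m n), completes `divide` to m/(m n) = 1/n.
  divide≤unitFraction : divide 𝕀.≤ unitFraction n
  divide≤unitFraction = 𝕀.≤-respʳ {divide} {divide 𝕀.⊕ rest} {unitFraction n}
    (fraction-≈ {y = unitFraction n}
      (fraction-⊕ (isQuotient j≤m) (isQuotient (ℕₚ.m∸n≤m m j)) j+rest≤)
      (unitFraction-isFraction n)
      (≡.trans (≡.cong (ℕ._* n) j+rest≡m) (≡.sym (ℕₚ.*-identityˡ _))))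
    (𝕀.x≤x⊕y divide rest)
    where
    rest : 𝕀.Carrier
    rest = quotient (ℕₚ.m∸n≤m m j)
    j+rest≡m : j ℕ.+ (m ℕ.∸ j) ≡ m
    j+rest≡m = ℕₚ.m+[n∸m]≡n j≤m
    j+rest≤ : j ℕ.+ (m ℕ.∸ j) ℕ.≤ m ℕ.* n
    j+rest≤ = ≡.subst (ℕ._≤ m ℕ.* n) (≡.sym j+rest≡m) m≤m*n

-- Division operators on the tensor product.

module RationalTensor (B : MVAlgebra b ℓ) (p : Level) where
  private module B = MVAlgebra B
  open MVTensor [0,1]ℚ B using (Term; _⊗ₜ_; _⊕ₜ_; _*ₜ; 0ₜ; lift; ⊗-congₜ; ⊗-1ₜ
    ; ⊗-∨ˡₜ; ⊗-∨ʳₜ; ⊗-∧ˡₜ; ⊗-∧ʳₜ; ⊗-⊥ˡₜ; ⊗-⊥ʳₜ; ⊗-+ˡₜ; ⊗-+ʳₜ)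
  open Quotient ([0,1]ℚ ⊗MV B) (Rad p _) using (≈⇒∼)

  algebra : MVAlgebra b (b ⊔ ℓ ⊔ lsuc p)
  algebra = [0,1]ℚ ⊗[ p ] B

  open MVOrder algebra

  semisimple : Semisimple p algebra
  semisimple = /Rad-semisimple ([0,1]ℚ ⊗MV B) p

  open SemisimpleProperties algebra semisimple

  bimorphism : Bimorphism [0,1]ℚ B algebra
  bimorphism = record
    { β      = _⊗ₜ_
    ; β-cong = λ q r → ≈⇒∼ (⊗-congₜ q r)
    ; β-1    = ≈⇒∼ ⊗-1ₜ
    ; β-∨ˡ   = λ x x′ y → ≈⇒∼ (⊗-∨ˡₜ x x′ y)
    ; β-∨ʳ   = λ x y y′ → ≈⇒∼ (⊗-∨ʳₜ x y y′)
    ; β-∧ˡ   = λ x x′ y → ≈⇒∼ (⊗-∧ˡₜ x x′ y)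
    ; β-∧ʳ   = λ x y y′ → ≈⇒∼ (⊗-∧ʳₜ x y y′)
    ; β-⊥ˡ   = λ y q → ≈⇒∼ (⊗-⊥ˡₜ y q)
    ; β-⊥ʳ   = λ x q → ≈⇒∼ (⊗-⊥ʳₜ x q)
    ; β-+ˡ   = λ y q → ≈⇒∼ (⊗-+ˡₜ y q)
    ; β-+ʳ   = λ x q → ≈⇒∼ (⊗-+ʳₜ x q)
    }

  open BimorphismProperties bimorphism using (isAdditiveˡ; β-mono) renaming
    (β-1-homomorphism to ι-homomorphism) public

  ⊗-part : ∀ k {n} .{{_ : NonZero n}} {x y} → 𝕀.Summable n x → k ℕ.≤ n → k 𝕀.· x 𝕀.≈ y →
           ∀ b → k · (x ⊗ₜ b) ≈ y ⊗ₜ b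
  ⊗-part k {n} {x} {y} s k≤n q b = trans (sym (IsAdditive.·-homo (isAdditiveˡ b) {n} k {x} s k≤n))
    (IsAdditive.cong (isAdditiveˡ b) {k 𝕀.· x} {y} q)

  module _ (n : ℕ) .{{_ : NonZero n}} where

    unitFraction-⊗-summable : ∀ b → Summable n (unitFraction n ⊗ₜ b)
    unitFraction-⊗-summable b =
      IsAdditive.summable-homo (isAdditiveˡ b) n {unitFraction n} (unitFraction-summable n)

    n·unitFraction-⊗ : ∀ b → n · (unitFraction n ⊗ₜ b) ≈ 𝕀.1# ⊗ₜ b
    n·unitFraction-⊗ = ⊗-part n {n} {unitFraction n} {𝕀.1#}
      (unitFraction-summable n) ℕₚ.≤-refl (n·unitFraction≈1 n)

    unit : Term
    unit = unitFraction n ⊗ₜ B.1#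

    n·unit≈1 : n · unit ≈ 1#
    n·unit≈1 = trans (n·unitFraction-⊗ B.1#) (Bimorphism.β-1 bimorphism)

  -- The clauses for * and ⊕ transcribe (1 − s)/n = 1/n − s/n and
  -- min(s + t, 1)/n = min(s/n + t/n, 1/n).
  δ : ∀ n .{{_ : NonZero n}} → Term → Term
  δ n (q ⊗ₜ b) = divide n q ⊗ₜ b
  δ n (s ⊕ₜ t) = (δ n s ⊕ δ n t) ∧ unit n
  δ n (s *ₜ)   = unit n ⊙ δ n s *
  δ n 0ₜ       = 0#

  module _ (n : ℕ) .{{_ : NonZero n}} where

    -- Summability passes to smaller elements, so this bound by the n-th part of `1#` yields it for
    -- every term at once.
    δ≤unit : ∀ t → δ n t ≤ unit n
    δ≤unit (q ⊗ₜ b) = β-mono {divide n q} {unitFraction n}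
      (divide≤unitFraction n q) (MVOrder.x≤1 B b)
    δ≤unit (s ⊕ₜ t) = x∧y≤y _ _
    δ≤unit (s *ₜ)   = x⊖y≤x _ _
    δ≤unit 0ₜ       = 0≤x _

    δ-summable : ∀ t → Summable n (δ n t)
    δ-summable t = summable-mono n (δ≤unit t) (unitFraction-⊗-summable n B.1#)

    ·-δ : ∀ t → n · δ n t ≈ t
    ·-δ (q ⊗ₜ b) = ⊗-part n {n} {divide n q} {q} (divide-summable n q) ℕₚ.≤-refl (n·divide n q) b
    -- Truncation at 1/n is absorbed by the truncation of the n-fold sum at 1.
    ·-δ (s ⊕ₜ t) = trans (·-∧-unit n _ (n·unit≈1 n))
      (trans (·-distrib-⊕ _ _ n) (⊕-cong (·-δ s) (·-δ t)))
    ·-δ (s *ₜ)   = trans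
      (summable-complement n (unitFraction-⊗-summable n B.1#) (n·unit≈1 n) (δ≤unit s))
      (*-cong (·-δ s))
    ·-δ 0ₜ       = n·0 n
      where
      n·0 : ∀ n → n · 0# ≈ 0#
      n·0 zero    = refl
      n·0 (suc n) = trans (⊕-identityˡ _) (n·0 n)

  divisionOperators : DivisionOperators algebra
  divisionOperators = record
    { δ      = δ
    -- The recursion is on the syntax of terms; that it respects equality modulo the radical comes
    -- from uniqueness of n-th parts.
    ; δ-cong = λ n {s} {t} q → part-unique n (δ-summable n s) (δ-summable n t)
        (trans (·-δ n s) (trans q (sym (·-δ n t))))
    ; ·-δ    = ·-δ
    ; δ-⊥    = δ-summable
    }

  module _ {C : MVAlgebra c ℓ₃} (C-semisimple : Semisimple p C) where
    private
      module C = MVOrder C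
      module Cₛ = SemisimpleProperties C C-semisimple

    -- q ⊗ b is a multiple of an n-th part of ι b, where n is the denominator of q.
    ι-epi : (g h : MVHomomorphism algebra C) → let module g = MVHomomorphism g
                                                   module h = MVHomomorphism h in
            (∀ b → g.⟦ 𝕀.1# ⊗ₜ b ⟧ C.≈ h.⟦ 𝕀.1# ⊗ₜ b ⟧) → g ≗MV h
    ι-epi g h q = go
      where
      module g where
        open MVHomomorphism g public
        open MVHomomorphismProperties g public
      module h where
        open MVHomomorphism h public
        open MVHomomorphismProperties h public

      on-unit : ∀ n .{{_ : NonZero n}} b →
                g.⟦ unitFraction n ⊗ₜ b ⟧ C.≈ h.⟦ unitFraction n ⊗ₜ b ⟧
      on-unit n b = Cₛ.part-unique n (g.summable-homo n s) (h.summable-homo n s)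
        (C.trans (C.sym (g.·-homo n _)) (C.trans (g.cong e) (C.trans (q b)
          (C.trans (h.cong (sym e)) (h.·-homo n _)))))
        where
        s : Summable n (unitFraction n ⊗ₜ b)
        s = unitFraction-⊗-summable n b
        e : n · (unitFraction n ⊗ₜ b) ≈ 𝕀.1# ⊗ₜ b
        e = n·unitFraction-⊗ n b

      go : ∀ t → g.⟦ t ⟧ C.≈ h.⟦ t ⟧
      go (x ⊗ₜ b) = C.trans (g.cong (sym e)) (C.trans (g.·-homo k _)
        (C.trans (C.·-congʳ k (on-unit n b)) (C.trans (C.sym (h.·-homo k _)) (h.cong e))))
        where
        k n : ℕ
        k = numerator x
        n = denominator x
        k≤n : k ℕ.≤ n
        k≤n = numerator≤denominator x
        e : k · (unitFraction n ⊗ₜ b) ≈ x ⊗ₜ b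
        e = ⊗-part k {n} {unitFraction n} {x} (unitFraction-summable n) k≤n
              (fraction-≈ {y = x} (k·unitFraction {k} {n} k≤n) (as-fraction x) ≡.refl) b
      go (s ⊕ₜ t) = C.trans (g.⊕-homo s t) (C.trans (C.⊕-cong (go s) (go t)) (C.sym (h.⊕-homo s t)))
      go (s *ₜ)   = C.trans (g.*-homo s) (C.trans (C.*-cong (go s)) (C.sym (h.*-homo s)))
      go 0ₜ       = C.trans g.0-homo (C.sym h.0-homo)

    module _ (C-divisible : DivisionOperators C) where
      open Scalar C C-semisimple C-divisible using (•-bimorphism; 1•)

      extend : MVHomomorphism B C → MVHomomorphism algebra C
      extend f = record
        { ⟦_⟧    = ⟦_⟧
        ; cong   = /Rad-cong h C-semisimple
        ; ⊕-homo = ⊕-homo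
        ; *-homo = *-homo
        ; 0-homo = 0-homo
        }
        where
        h : MVHomomorphism ([0,1]ℚ ⊗MV B) C
        h = lift (•-bimorphism ∘ʳ f)
        open MVHomomorphism h

      extend-ι : (f : MVHomomorphism B C) → extend f ∘MV ι-homomorphism ≗MV f
      extend-ι f b = 1• (MVHomomorphism.⟦_⟧ f b)

δ-homo : {A : MVAlgebra a ℓ₁} {B : MVAlgebra b ℓ₂} → Semisimple p B →
         (δᴬ : DivisionOperators A) (δᴮ : DivisionOperators B) (f : MVHomomorphism A B) →
         let open MVHomomorphism f in ∀ n .{{_ : NonZero n}} x →
         MVAlgebra._≈_ B ⟦ DivisionOperators.δ δᴬ n x ⟧ (DivisionOperators.δ δᴮ n ⟦ x ⟧)
δ-homo {B = B} semisimple δᴬ δᴮ f n x =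
  SemisimpleProperties.part-unique B semisimple n (summable-homo n (δᴬ.δ-⊥ n x)) (δᴮ.δ-⊥ n _)
    (B.trans (B.sym (·-homo n _)) (B.trans (cong (δᴬ.·-δ n x)) (B.sym (δᴮ.·-δ n _))))
  where
  module B = MVAlgebra B
  module δᴬ = DivisionOperators δᴬ
  module δᴮ = DivisionOperators δᴮ
  open MVHomomorphism f
  open MVHomomorphismProperties f

module _ {c p : Level} where
  private
    module MV  = Category (MVss c p)
    module DMV = Category (DMVss c p)
    module RT (B : MV.Obj) = RationalTensor (SemisimpleMVAlgebra.mvAlgebra B) p
    module 𝒰 = Functor (𝒰δ c p)
    open DMVHomomorphism using (mvHomomorphism)

  module Transpose (A : MV.Obj) (δs : DivisionOperators ([0,1]ℚ⊗ A)) (Y : DMV.Obj) where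
    open SemisimpleDMVAlgebra Y
    open DMVAlgebra dmvAlgebra

    transpose : A MV.⇒ 𝒰.F₀ Y → divisible A δs DMV.⇒ Y
    transpose f = record
      { mvHomomorphism = f̂
      ; δ-homo         = δ-homo semisimple δs divisionOperators f̂
      }
      where
      f̂ : MVHomomorphism ([0,1]ℚ⊗ A) mvAlgebra
      f̂ = RT.extend A semisimple divisionOperators f

    restrict : divisible A δs DMV.⇒ Y → A MV.⇒ 𝒰.F₀ Y
    restrict k = mvHomomorphism k ∘MV RT.ι-homomorphism A

    restrict-transpose : ∀ f → restrict (transpose f) ≗MV f
    restrict-transpose = RT.extend-ι A semisimple divisionOperators

    restrict-injective : ∀ k l → restrict k ≗MV restrict l → mvHomomorphism k ≗MV mvHomomorphism l
    restrict-injective k l =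
      RT.ι-epi A semisimple (mvHomomorphism k) (mvHomomorphism l)

    inverse : Inverse (DMV.homSetoid (divisible A δs) Y) (MV.homSetoid A (𝒰.F₀ Y))
    inverse = record
      { to        = restrict
      ; from      = transpose
      ; to-cong   = λ q a → q (ι A a)
      ; from-cong = λ {f} {g} q → restrict-injective (transpose f) (transpose g) λ a →
          trans (restrict-transpose f a) (trans (q a) (sym (restrict-transpose g a)))
      ; inverse   = (λ {f} q a → trans (q (ι A a)) (restrict-transpose f a))
                  , (λ {k} {f} q → restrict-injective (transpose f) k λ a →
                      trans (restrict-transpose f a) (q a))
      }

  divisibleTensor : DivisibleTensor c p
  divisibleTensor = record
    { divisionOperators = RT.divisionOperators
    ; tilde             = λ A B f → transpose A B (RT.ι-homomorphism B ∘MV f)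
    ; tilde-extends     = λ A B f → restrict-transpose A B (RT.ι-homomorphism B ∘MV f)
    ; tilde-unique      = λ A B f g g-extends → let open MVAlgebra ([0,1]ℚ⊗ B) in
        restrict-injective A B g (transpose A B (RT.ι-homomorphism B ∘MV f)) λ a →
          trans (g-extends a) (sym (restrict-transpose A B (RT.ι-homomorphism B ∘MV f) a))
    }
    where
    module _ (A B : MV.Obj) where
      open Transpose A (RT.divisionOperators A) (divisible B (RT.divisionOperators B)) public

  adjunction : (T : DivisibleTensor c p) → DivisibleTensor.𝒟⊗ T ⊣ 𝒰δ c p
  adjunction T = record
    { hom-iso = λ X → Transpose.inverse X (divisionOperators X)
    ; natural = λ {X} {X′} f g k a → MVHomomorphism.cong (mvHomomorphism g)
        (MVHomomorphism.cong (mvHomomorphism k) (tilde-extends X′ X f a))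
    }
    where open DivisibleTensor T

theorem3p1 : (c p : Level) →
    DivisibleTensor c p × ((T : DivisibleTensor c p) → DivisibleTensor.𝒟⊗ T ⊣ 𝒰δ c p)
theorem3p1 c p = divisibleTensor , adjunction
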